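{- Let $T$ be a (finite) tree. Then $T$ is palindromic if and only if $T$ is isomorphic to the hairing $H(T')$ of some tree $T'$ with an even number of vertices; and $T$ is antipalindromic if and only if $T$ is isomorphic to the hairing $H(T')$ of some tree $T'$ with an odd number of vertices.
   Context: All graphs are finite, simple and undirected. For a graph $G$ on $n$ vertices with adjacency matrix $A_G$, its characteristic polynomial is $\chi_G(\lambda)=\det(\lambda I-A_G)=a_0\lambda^n+a_1\lambda^{n-1}+\dots+a_{n-1}\lambda+a_n$ (so $a_0=1$). $G$ is called palindromic if $a_i=a_{n-i}$ for all $i=0,\dots,n$, and antipalindromic if $a_i=-a_{n-i}$ for all $i=0,\dots,n$. The hairing $H(G)$ of a graph $G=(V,E)$ is the graph obtained from $G$ by adding, for each vertex $v\in V$, one new vertex $v'$ adjacent only to $v$ (a pendant vertex); equivalently, $H(G)$ has vertex set $V\times\{0,1\}$, with $(u,0)\sim(v,0)$ iff $uv\in E$, and $(u,0)\sim(u,1)$ for every $u\in V$, and no other edges. -}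

module Defs where

open import Data.Bool using (Bool; true; false; if_then_else_)
open import Data.Nat as ℕ using (ℕ; zero; suc; _∸_; _≤_)
open import Data.Nat.Divisibility using (_∣_)
open import Data.Integer as ℤ using (ℤ; +_; -_)
open import Data.Fin as Fin using (Fin; zero; suc; toℕ; splitAt; punchIn)
open import Data.List using (List; []; _∷_; _++_; length)
open import Data.List.Relation.Unary.Unique.Propositional using (Unique)
open import Data.List.Relation.Unary.Linked using (Linked)
open import Data.Product using (Σ; _×_; ∃; ∃-syntax)
open import Data.Sum using (inj₁; inj₂)
open import Relation.Nullary using (¬_; does)
open import Relation.Binary.PropositionalEquality using (_≡_)
open import Function.Bundles using (_↔_; Inverse)

record Graph : Set where
  field
    n      : ℕ
    adj    : Fin n → Fin n → Bool
    sym    : ∀ u v → adj u v ≡ adj v u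
    irrefl : ∀ u → adj u u ≡ false
open Graph public

Adj : (G : Graph) → Fin (n G) → Fin (n G) → Set
Adj G u v = adj G u v ≡ true

data Walk (G : Graph) : Fin (n G) → Fin (n G) → Set where
  [] : ∀ {u} → Walk G u u
  _∷_ : ∀ {u v w} → Adj G u v → Walk G v w → Walk G u w

Connected : Graph → Set
Connected G = ∀ u v → Walk G u v

Cycle : Graph → Set
Cycle G = Σ (Fin (n G)) λ v → Σ (List (Fin (n G))) λ ws →
  (3 ≤ length (v ∷ ws)) × Unique (v ∷ ws) × Linked (Adj G) (v ∷ ws ++ v ∷ [])

Acyclic : Graph → Set
Acyclic G = ¬ Cycle G

IsTree : Graph → Set
IsTree G = (1 ≤ n G) × Connected G × Acyclic G

_≅_ : Graph → Graph → Set
G ≅ H = Σ (Fin (n G) ↔ Fin (n H)) λ f →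
  ∀ u v → adj G u v ≡ adj H (Inverse.to f u) (Inverse.to f v)

-- Hairing: vertex set V × {0,1} encoded as Fin (n + n) via splitAt
-- (inj₁ u = (u,0), inj₂ u = (u,1))

private
  eqb : ∀ {m} → Fin m → Fin m → Bool
  eqb u v = does (u Fin.≟ v)

hairAdj : (G : Graph) → Fin (n G ℕ.+ n G) → Fin (n G ℕ.+ n G) → Bool
hairAdj G x y with splitAt (n G) x | splitAt (n G) y
... | inj₁ u | inj₁ v = adj G u v
... | inj₁ u | inj₂ v = eqb u v
... | inj₂ u | inj₁ v = eqb u v
... | inj₂ u | inj₂ v = false

private
  eqb-sym : ∀ {m} (u v : Fin m) → eqb u v ≡ eqb v u
  eqb-sym u v with u Fin.≟ v | v Fin.≟ u
  ... | Relation.Nullary.yes _ | Relation.Nullary.yes _ = Relation.Binary.PropositionalEquality.refl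
  ... | Relation.Nullary.no _ | Relation.Nullary.no _ = Relation.Binary.PropositionalEquality.refl
  ... | Relation.Nullary.yes p | Relation.Nullary.no q = Data.Empty.⊥-elim (q (Relation.Binary.PropositionalEquality.sym p))
    where import Data.Empty
  ... | Relation.Nullary.no q | Relation.Nullary.yes p = Data.Empty.⊥-elim (q (Relation.Binary.PropositionalEquality.sym p))
    where import Data.Empty

hairSym : (G : Graph) → ∀ x y → hairAdj G x y ≡ hairAdj G y x
hairSym G x y with splitAt (n G) x | splitAt (n G) y
... | inj₁ u | inj₁ v = sym G u v
... | inj₁ u | inj₂ v = eqb-sym u v
... | inj₂ u | inj₁ v = eqb-sym u v
... | inj₂ u | inj₂ v = Relation.Binary.PropositionalEquality.refl

hairIrrefl : (G : Graph) → ∀ x → hairAdj G x x ≡ false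
hairIrrefl G x with splitAt (n G) x
... | inj₁ u = irrefl G u
... | inj₂ u = Relation.Binary.PropositionalEquality.refl

H : Graph → Graph
H G = record
  { n = n G ℕ.+ n G
  ; adj = hairAdj G
  ; sym = hairSym G
  ; irrefl = hairIrrefl G
  }

-- Polynomials over ℤ as coefficient lists (ascending powers)

Poly : Set
Poly = List ℤ

_⊕_ : Poly → Poly → Poly
[] ⊕ q = q
(a ∷ p) ⊕ [] = a ∷ p
(a ∷ p) ⊕ (b ∷ q) = (a ℤ.+ b) ∷ (p ⊕ q)

scale : ℤ → Poly → Poly
scale c [] = []
scale c (a ∷ p) = (c ℤ.* a) ∷ scale c p

_⊗_ : Poly → Poly → Poly
[] ⊗ q = []
(a ∷ p) ⊗ q = scale a q ⊕ (+ 0 ∷ (p ⊗ q))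

neg : Poly → Poly
neg = scale (- (+ 1))

coeff : Poly → ℕ → ℤ
coeff [] _ = + 0
coeff (a ∷ p) zero = a
coeff (a ∷ p) (suc k) = coeff p k

det : ∀ m → (Fin m → Fin m → Poly) → Poly
det zero M = + 1 ∷ []
det (suc m) M = go (suc m) (λ j → j) (+ 1)
  where
  minor : Fin (suc m) → Fin m → Fin m → Poly
  minor j i k = M (suc i) (punchIn j k)
  term : Fin (suc m) → Poly
  term j = M zero j ⊗ det m (minor j)
  go : ∀ k → (Fin k → Fin (suc m)) → ℤ → Poly
  go zero e s = []
  go (suc k) e s = scale s (term (e zero)) ⊕ go k (λ i → e (suc i)) (- s)

charMatrix : (G : Graph) → Fin (n G) → Fin (n G) → Poly
charMatrix G i j =
  (if eqb i j then (+ 0 ∷ + 1 ∷ []) else [])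
  ⊕ (if adj G i j then (- (+ 1) ∷ []) else [])

χ : Graph → Poly
χ G = det (n G) (charMatrix G)

a : (G : Graph) → ℕ → ℤ
a G i = coeff (χ G) (n G ∸ i)

Palindromic : Graph → Set
Palindromic G = ∀ (i : Fin (suc (n G))) → a G (toℕ i) ≡ a G (n G ∸ toℕ i)

Antipalindromic : Graph → Set
Antipalindromic G = ∀ (i : Fin (suc (n G))) → a G (toℕ i) ≡ - a G (n G ∸ toℕ i)

{-# OPTIONS --safe #-}
module Submission where

-- A rooted tree is built from single vertices by t ⋈ s, which hangs s below the root of t. If P, Q are the
-- characteristic polynomials of a tree and of the tree minus its root, then P(t ⋈ s) = P(t)P(s) - Q(t)Q(s)
-- and Q(t ⋈ s) = Q(t)P(s); this follows by eliminating leaves from the determinant.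
--
-- Hairing replaces each vertex by an edge, i.e. the initial pair (λ, 1) by (λ² - 1, λ). Under λ ↦ 1/λ with
-- degree 2 these become -(λ² - 1) and λ, and the recursion preserves the resulting (anti)symmetry.
--
-- Conversely, if T is (anti)palindromic, then the constant coefficient of χ is ±1, so T has a perfect
-- matching, and the coefficient of λ² is, up to sign, that of λⁿ⁻², namely n - 1. But that coefficient counts
-- the matchings with one edge less than a perfect one; by the recursion there are at least n - 1 of them, with
-- equality only if every edge of the perfect matching contains a leaf, that is, if T is a hairing.

open import Algebra.Bundles using (CommutativeRing)
open import Data.Fin as Fin using (Fin; zero; suc; punchIn; punchOut; splitAt; toℕ; fromℕ<)
open import Data.Fin.Permutation as Perm using (Permutation′; _⟨$⟩ʳ_; remove; punchIn-permute)
open import Data.Nat as ℕ using (ℕ; zero; suc; _∸_; _≤_; _<_; z≤n; s≤s)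
open import Data.Product using (Σ; _×_; _,_; proj₁; proj₂)
open import Function using (_∘_; id)
open import Relation.Binary.PropositionalEquality as ≡ using (_≡_; _≢_; cong; cong₂; subst; module ≡-Reasoning)

-- Eliminating a leaf from λI - A divides by its pivot, so vertices carry fractions p/q in place of
-- λ: removing a leaf of weight p'/q' turns p/q at its neighbour into p/q - q'/p' = (pp' -
-- qq')/(qp'). This is the origin of the recursion, P/Q being the weight collected at the root.
-- Scaling each row by its denominator removes the divisions, but the induction then runs over
-- arbitrary weights and one leaf at a time.
--
-- The bound n - 1 does not carry an induction by itself. Joining hairings at pendant ends of hairs
-- gives in general no hairing, so the position of the root matters. It is read off from the number
-- of matchings that miss one vertex of the tree minus its root: in a hairing this is 1 exactly when
-- the root can be taken in the core. All bounds are kept as equations with slacks in ℕ. The slack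
-- of a join is a polynomial with nonnegative coefficients in the slacks and root degrees of its
-- parts, and equality means that it vanishes. Its only term free of slacks is the product of the
-- two root degrees, which arises when the joining edge lies in the perfect matching; it forces a
-- leaf.

module Determinant {c ℓ} (R : CommutativeRing c ℓ) where
  open CommutativeRing R hiding (ring; zero)
  open import Relation.Binary.Reasoning.Setoid setoid

  open import Algebra.Properties.Ring (CommutativeRing.ring R)
    using (-‿distribˡ-*; -‿distribʳ-*; x[y-z]≈xy-xz; [y-z]x≈yx-zx; -1*x≈-x; -‿+-comm; -‿involutive)
  import Algebra.Properties.CommutativeSemigroup as CommutativeSemigroup
  private
    module + = CommutativeSemigroup +-commutativeSemigroup
    module * = CommutativeSemigroup *-commutativeSemigroup

  -- Nested subtraction yields the signs of a cofactor expansion without powers of -1 or parities of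
  -- indices.
  alt : ∀ {k} → (Fin k → Carrier) → Carrier
  alt {zero}  f = 0#
  alt {suc k} f = f zero - alt (f ∘ suc)

  alt-cong : ∀ {k} {f g : Fin k → Carrier} → (∀ i → f i ≈ g i) → alt f ≈ alt g
  alt-cong {zero}  f≈g = refl
  alt-cong {suc k} f≈g = +-cong (f≈g zero) (-‿cong (alt-cong (f≈g ∘ suc)))

  private
    0≈0-0 : 0# ≈ 0# - 0#
    0≈0-0 = sym (-‿inverseʳ 0#)

    interchange : ∀ a b x y → (a - x) - (b - y) ≈ (a - b) - (x - y)
    interchange a b x y = begin
      (a - x) - (b - y)        ≈⟨ +-congˡ (-‿+-comm b (- y)) ⟨
      (a - x) + (- b - - y)    ≈⟨ +.interchange a (- x) (- b) (- - y) ⟩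
      (a - b) + (- x - - y)    ≈⟨ +-congˡ (-‿+-comm x (- y)) ⟩
      (a - b) - (x - y)        ∎

  alt-0 : ∀ {k} {f : Fin k → Carrier} → (∀ i → f i ≈ 0#) → alt f ≈ 0#
  alt-0 {zero}  f≈0 = refl
  alt-0 {suc k} f≈0 = trans (+-cong (f≈0 zero) (-‿cong (alt-0 (f≈0 ∘ suc)))) (sym 0≈0-0)

  alt-- : ∀ {k} (f g : Fin k → Carrier) → alt f - alt g ≈ alt (λ i → f i - g i)
  alt-- {zero}  f g = sym 0≈0-0
  alt-- {suc k} f g = trans (interchange _ _ _ _) (+-congˡ (-‿cong (alt-- (f ∘ suc) (g ∘ suc))))

  alt-‿ : ∀ {k} (f : Fin k → Carrier) → - alt f ≈ alt (λ i → - f i)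
  alt-‿ {zero}  f = trans (sym (+-identityˡ (- 0#))) (sym 0≈0-0)
  alt-‿ {suc k} f = trans (sym (-‿+-comm _ _)) (+-congˡ (-‿cong (alt-‿ (f ∘ suc))))

  alt-* : ∀ {k} c (f : Fin k → Carrier) → c * alt f ≈ alt (λ i → c * f i)
  alt-* {zero}  c f = zeroʳ c
  alt-* {suc k} c f = trans (x[y-z]≈xy-xz _ _ _) (+-congˡ (-‿cong (alt-* c (f ∘ suc))))

  alt-comm : ∀ {k l} (f : Fin k → Fin l → Carrier) →
             alt (λ i → alt (f i)) ≈ alt (λ j → alt (λ i → f i j))
  alt-comm {zero} {l} f = sym (alt-0 {l} (λ _ → refl))
  alt-comm {suc k} f = trans (+-congˡ (-‿cong (alt-comm (f ∘ suc)))) (alt-- (f zero) _)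

  alt-exchange : ∀ {k l} (a : Fin k → Carrier) (b : Fin l → Carrier) (D : Fin k → Fin l → Carrier) →
                 alt (λ i → a i * alt (λ j → b j * D i j)) ≈ alt (λ j → b j * alt (λ i → a i * D i j))
  alt-exchange {k} {l} a b D = begin
    alt (λ i → a i * alt (λ j → b j * D i j))    ≈⟨ alt-cong {k} (λ i → alt-* {l} (a i) _) ⟩
    alt (λ i → alt (λ j → a i * (b j * D i j)))  ≈⟨ alt-comm {k} {l} _ ⟩
    alt (λ j → alt (λ i → a i * (b j * D i j)))
      ≈⟨ alt-cong (λ j → alt-cong (λ i → *.x∙yz≈y∙xz (a i) (b j) (D i j))) ⟩
    alt (λ j → alt (λ i → b j * (a i * D i j)))  ≈⟨ alt-cong {l} (λ j → alt-* {k} (b j) _) ⟨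
    alt (λ j → b j * alt (λ i → a i * D i j))    ∎

  alt-scale : ∀ {k} s (a x y : Fin k → Carrier) → (∀ i → x i ≈ s * y i) →
              alt (λ i → a i * x i) ≈ s * alt (λ i → a i * y i)
  alt-scale {k} s a x y x≈sy =
    trans (alt-cong (λ i → trans (*-congˡ (x≈sy i)) (*.x∙yz≈y∙xz (a i) s (y i)))) (sym (alt-* {k} s _))

  -- Determinants over a commutative ring

  Matrix : ℕ → Set c
  Matrix m = Fin m → Fin m → Carrier

  _ᵀ : ∀ {m} → Matrix m → Matrix m
  (M ᵀ) i j = M j i

  minor : ∀ {m} → Matrix (suc m) → Fin (suc m) → Matrix m
  minor M j i k = M (suc i) (punchIn j k)

  det : ∀ {m} → Matrix m → Carrier
  det {zero}  M = 1#
  det {suc m} M = alt (λ j → M zero j * det (minor M j))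

  det-cong : ∀ {m} {M N : Matrix m} → (∀ i j → M i j ≈ N i j) → det M ≈ det N
  det-cong {zero}  M≈N = refl
  det-cong {suc m} M≈N =
    alt-cong (λ j → *-cong (M≈N zero j) (det-cong (λ i k → M≈N (suc i) (punchIn j k))))

  -- Expanding along the first row and then the first column of each minor,
  -- or the other way round, gives the same double sum.
  det-ᵀ : ∀ {m} (M : Matrix m) → det M ≈ det (M ᵀ)
  det-ᵀ {zero}        M = refl
  det-ᵀ {suc zero}    M = refl
  det-ᵀ {suc (suc m)} M = +-cong (*-congˡ (det-ᵀ (minor M zero))) (-‿cong (begin
    alt (λ j → M zero (suc j) * det (minor M (suc j)))
      ≈⟨ alt-cong {suc m} (λ j → *-congˡ {M zero (suc j)} (det-ᵀ (minor M (suc j)))) ⟩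
    alt (λ j → M zero (suc j) * alt (λ i → M (suc i) zero * det (minor (minor M (suc j) ᵀ) i)))
      ≈⟨ alt-exchange {suc m} {suc m} (λ j → M zero (suc j)) (λ i → M (suc i) zero)
           (λ j i → det (minor (minor M (suc j) ᵀ) i)) ⟩
    alt (λ i → M (suc i) zero * alt (λ j → M zero (suc j) * det (minor (minor M (suc j) ᵀ) i)))
      ≈⟨ alt-cong {suc m} (λ i → *-congˡ {M (suc i) zero} (begin
           alt (λ j → M zero (suc j) * det (minor (minor M (suc j) ᵀ) i))
             ≈⟨ alt-cong {suc m} (λ j → *-congˡ {M zero (suc j)} (det-ᵀ (minor (minor M (suc j) ᵀ) i))) ⟩
           alt (λ j → M zero (suc j) * det (minor (minor (M ᵀ) (suc i) ᵀ) j))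
             ≈⟨ det-ᵀ (minor (M ᵀ) (suc i)) ⟨
           det (minor (M ᵀ) (suc i)) ∎)) ⟩
    alt (λ i → M (suc i) zero * det (minor (M ᵀ) (suc i))) ∎))

  swap₀₁ : ∀ {m} → Fin (suc (suc m)) → Fin (suc (suc m))
  swap₀₁ zero          = suc zero
  swap₀₁ (suc zero)    = zero
  swap₀₁ (suc (suc i)) = suc (suc i)

  private
    swap-terms : ∀ x y z → x - (y - - z) ≈ - (y - (x - z))
    swap-terms x y z = begin
      x - (y - - z)        ≈⟨ +-congˡ (-‿+-comm y (- - z)) ⟨
      x + (- y - - - z)    ≈⟨ +-congˡ (+-congˡ (-‿involutive (- z))) ⟩
      x + (- y - z)        ≈⟨ +.x∙yz≈y∙xz x (- y) (- z) ⟩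
      - y + (x - z)        ≈⟨ +-congˡ (-‿involutive (x - z)) ⟨
      - y - - (x - z)      ≈⟨ -‿+-comm y (- (x - z)) ⟩
      - (y - (x - z))      ∎

  -- In the expansion along the first row the two leading terms trade places and thereby signs;
  -- every later minor still begins with the two swapped columns, so induction applies to it.
  det-swapColumns : ∀ {m} (M : Matrix (suc (suc m))) →
                    det (λ i j → M i (swap₀₁ j)) ≈ - det M
  det-swapColumns {m} M = trans
    (+-cong (*-congˡ (det-cong minor₀)) (-‿cong (+-cong (*-congˡ (det-cong minor₁)) (-‿cong (begin
      alt (λ j → M zero (suc (suc j)) * det (minor (λ i j → M i (swap₀₁ j)) (suc (suc j))))
        ≈⟨ alt-cong (λ j → trans (*-congˡ (minor₂ M j)) (sym (-‿distribʳ-* _ _))) ⟩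
      alt (λ j → - (M zero (suc (suc j)) * det (minor M (suc (suc j)))))
        ≈⟨ alt-‿ {m} _ ⟨
      - alt (λ j → M zero (suc (suc j)) * det (minor M (suc (suc j)))) ∎)))))
    (swap-terms _ _ _)
    where
    minor₀ : ∀ i k → minor (λ i j → M i (swap₀₁ j)) zero i k ≈ minor M (suc zero) i k
    minor₀ i zero    = refl
    minor₀ i (suc k) = refl
    minor₁ : ∀ i k → minor (λ i j → M i (swap₀₁ j)) (suc zero) i k ≈ minor M zero i k
    minor₁ i zero    = refl
    minor₁ i (suc k) = refl
    minor₂ : ∀ {m} (M : Matrix (suc (suc m))) j →
             det (minor (λ i j → M i (swap₀₁ j)) (suc (suc j))) ≈ - det (minor M (suc (suc j)))
    minor₂ {suc m} M j = trans (det-cong pointwise) (det-swapColumns (minor M (suc (suc j))))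
      where
      pointwise : ∀ i k → minor (λ i j → M i (swap₀₁ j)) (suc (suc j)) i k
                        ≈ minor M (suc (suc j)) i (swap₀₁ k)
      pointwise i zero          = refl
      pointwise i (suc zero)    = refl
      pointwise i (suc (suc k)) = refl

  -- The sign need not be identified: a simultaneous permutation of rows and columns only sees its square.
  RowSign : ∀ {m} → (Fin m → Fin m) → Set _
  RowSign {m} ρ = Σ Carrier λ s → (s * s ≈ 1#) × ((M : Matrix m) → det (λ i → M (ρ i)) ≈ s * det M)

  rowSign-id : ∀ {m} → RowSign {m} id
  rowSign-id = 1# , *-identityˡ 1# , λ M → sym (*-identityˡ _)

  rowSign-resp : ∀ {m} {ρ σ : Fin m → Fin m} → (∀ i → σ i ≡ ρ i) → RowSign ρ → RowSign σ
  rowSign-resp σ≗ρ (s , ss≈1 , eq) =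
    s , ss≈1 , λ M → trans (det-cong (λ i j → reflexive (≡.cong (λ r → M r j) (σ≗ρ i)))) (eq M)

  rowSign-∘ : ∀ {m} {ρ σ : Fin m → Fin m} → RowSign ρ → RowSign σ → RowSign (ρ ∘ σ)
  rowSign-∘ {ρ = ρ} (s , ss≈1 , eqρ) (t , tt≈1 , eqσ) =
    t * s ,
    trans (*.interchange t s t s) (trans (*-cong tt≈1 ss≈1) (*-identityˡ 1#)) ,
    λ M → trans (eqσ (λ i → M (ρ i))) (trans (*-congˡ (eqρ M)) (sym (*-assoc _ _ _)))

  lift : ∀ {m} → (Fin m → Fin m) → Fin (suc m) → Fin (suc m)
  lift ρ zero    = zero
  lift ρ (suc i) = suc (ρ i)

  rowSign-lift : ∀ {m} {ρ : Fin m → Fin m} → RowSign ρ → RowSign (lift ρ)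
  rowSign-lift {m} (s , ss≈1 , eq) =
    s , ss≈1 , λ M → alt-scale s (M zero) _ (λ j → det (minor M j)) (λ j → eq (minor M j))

  rowSign-swap₀₁ : ∀ {m} → RowSign (swap₀₁ {m})
  rowSign-swap₀₁ = - 1# , trans (-1*x≈-x (- 1#)) (-‿involutive 1#) ,
    λ M → trans (det-ᵀ (λ i → M (swap₀₁ i))) (trans (det-swapColumns (M ᵀ))
            (trans (-‿cong (sym (det-ᵀ M))) (sym (-1*x≈-x (det M)))))

  toFront : ∀ {m} → Fin (suc m) → Fin (suc m) → Fin (suc m)
  toFront v zero    = v
  toFront v (suc i) = punchIn v i

  -- Row v + 1 first comes to the front of the rows below row 0 and then passes row 0, so only swaps
  -- of two leading rows occur.
  rowSign-toFront : ∀ {m} (v : Fin (suc m)) → RowSign (toFront v)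
  rowSign-toFront {m} zero = rowSign-resp {ρ = id} pointwise rowSign-id
    where
    pointwise : ∀ i → toFront zero i ≡ i
    pointwise zero    = ≡.refl
    pointwise (suc i) = ≡.refl
  rowSign-toFront {suc m} (suc v) =
    rowSign-resp pointwise
      (rowSign-∘ {ρ = lift (toFront v)} {σ = swap₀₁} (rowSign-lift {ρ = toFront v} (rowSign-toFront v)) rowSign-swap₀₁)
    where
    pointwise : ∀ i → toFront (suc v) i ≡ lift (toFront v) (swap₀₁ i)
    pointwise zero          = ≡.refl
    pointwise (suc zero)    = ≡.refl
    pointwise (suc (suc i)) = ≡.refl

  -- Factoring out the image of 0 leaves a permutation that fixes 0, hence one on fewer indices.
  rowSign-permutation : ∀ {m} (π : Permutation′ m) → RowSign (π ⟨$⟩ʳ_)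
  rowSign-permutation {zero}  π = rowSign-resp {ρ = id} {σ = π ⟨$⟩ʳ_} (λ ()) rowSign-id
  rowSign-permutation {suc m} π =
    rowSign-resp pointwise
      (rowSign-∘ {ρ = toFront (π ⟨$⟩ʳ zero)} {σ = lift (remove zero π ⟨$⟩ʳ_)}
        (rowSign-toFront (π ⟨$⟩ʳ zero)) (rowSign-lift {ρ = remove zero π ⟨$⟩ʳ_} (rowSign-permutation (remove zero π))))
    where
    pointwise : ∀ i → π ⟨$⟩ʳ i ≡ toFront (π ⟨$⟩ʳ zero) (lift (remove zero π ⟨$⟩ʳ_) i)
    pointwise zero    = ≡.refl
    pointwise (suc i) = punchIn-permute π zero i

  det-permute : ∀ {m} (π : Permutation′ m) (M : Matrix m) →
                det (λ i j → M (π ⟨$⟩ʳ i) (π ⟨$⟩ʳ j)) ≈ det M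
  det-permute π M with rowSign-permutation π
  ... | s , ss≈1 , eq = begin
    det (λ i j → M (π ⟨$⟩ʳ i) (π ⟨$⟩ʳ j))  ≈⟨ eq (λ i j → M i (π ⟨$⟩ʳ j)) ⟩
    s * det (λ i j → M i (π ⟨$⟩ʳ j))       ≈⟨ *-congˡ (det-ᵀ (λ i j → M i (π ⟨$⟩ʳ j))) ⟩
    s * det (λ i → (M ᵀ) (π ⟨$⟩ʳ i))       ≈⟨ *-congˡ (eq (M ᵀ)) ⟩
    s * (s * det (M ᵀ))                    ≈⟨ *-assoc _ _ _ ⟨
    s * s * det (M ᵀ)                      ≈⟨ *-cong ss≈1 (sym (det-ᵀ M)) ⟩
    1# * det M                             ≈⟨ *-identityˡ _ ⟩
    det M                                  ∎

  private
    x-0≈x : ∀ x → x - 0# ≈ x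
    x-0≈x x = trans (+-congˡ (trans (sym (+-identityˡ (- 0#))) (-‿inverseʳ 0#))) (+-identityʳ x)

    x≈0⇒xy≈0 : ∀ {x} y → x ≈ 0# → x * y ≈ 0#
    x≈0⇒xy≈0 y x≈0 = trans (*-congʳ x≈0) (zeroˡ y)

    -- `D` stands for the minor without the first two rows and columns, `A` for the remaining terms
    -- of the expansion along the second row.
    pivot-algebra : ∀ pv qv pu qu D A →
      pv * (pu * D - A) - (- qv * (- qu * D - 0#) - 0#) ≈ (pu * pv - qu * qv) * D - pv * A
    pivot-algebra pv qv pu qu D A = begin
      pv * (pu * D - A) - (- qv * (- qu * D - 0#) - 0#)
        ≈⟨ +-cong (x[y-z]≈xy-xz pv (pu * D) A) (-‿cong (trans (x-0≈x _) (*-congˡ (x-0≈x _)))) ⟩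
      (pv * (pu * D) - pv * A) - - qv * (- qu * D)
        ≈⟨ +.xy∙z≈xz∙y _ _ _ ⟩
      (pv * (pu * D) - - qv * (- qu * D)) - pv * A
        ≈⟨ +-congʳ (+-cong (*.x∙yz≈yx∙z pv pu D) (-‿cong (begin
             - qv * (- qu * D)   ≈⟨ *-congˡ (-‿distribˡ-* qu D) ⟨
             - qv * - (qu * D)   ≈⟨ -‿distribˡ-* qv _ ⟨
             - (qv * - (qu * D)) ≈⟨ -‿cong (-‿distribʳ-* qv _) ⟨
             - - (qv * (qu * D)) ≈⟨ -‿involutive _ ⟩
             qv * (qu * D)       ≈⟨ *.x∙yz≈yx∙z qv qu D ⟩
             qu * qv * D         ∎))) ⟩
      (pu * pv * D - qu * qv * D) - pv * A
        ≈⟨ +-congʳ ([y-z]x≈yx-zx D _ _) ⟨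
      (pu * pv - qu * qv) * D - pv * A ∎

  -- The Schur complement of the first pivot, with the next row multiplied by the pivot to avoid dividing by it.
  det-eliminate : ∀ {m} (pv qv pu qu : Carrier) (M : Matrix (suc (suc m))) (N : Matrix (suc m)) →
    M zero zero ≈ pv → M zero (suc zero) ≈ - qv → (∀ j → M zero (suc (suc j)) ≈ 0#) →
    M (suc zero) zero ≈ - qu → (∀ i → M (suc (suc i)) zero ≈ 0#) →
    M (suc zero) (suc zero) ≈ pu →
    N zero zero ≈ pu * pv - qu * qv →
    (∀ j → N zero (suc j) ≈ pv * M (suc zero) (suc (suc j))) →
    (∀ i j → N (suc i) j ≈ M (suc (suc i)) (suc j)) →
    det M ≈ det N
  det-eliminate {m} pv qv pu qu M N M₀₀ M₀₁ M₀ⱼ M₁₀ Mᵢ₀ M₁₁ N₀₀ N₀ⱼ Nᵢⱼ = begin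
    det M
      ≈⟨ +-cong (*-cong M₀₀ (+-congʳ (*-congʳ M₁₁))) (-‿cong (+-cong (*-cong M₀₁ (begin
           -- Column 0 of this minor vanishes below its top entry; after transposition the row
           -- expansion collapses to that entry.
           det (minor M (suc zero))
             ≈⟨ det-ᵀ (minor M (suc zero)) ⟩
           det (minor M (suc zero) ᵀ)
             ≈⟨ +-cong (*-cong M₁₀ (sym (det-ᵀ D))) (-‿cong (alt-0 (λ i → x≈0⇒xy≈0 _ (Mᵢ₀ i)))) ⟩
           - qu * det D - 0# ∎))
         (-‿cong (alt-0 (λ j → x≈0⇒xy≈0 _ (M₀ⱼ j)))))) ⟩
    pv * (pu * det D - A) - (- qv * (- qu * det D - 0#) - 0#)
      ≈⟨ pivot-algebra pv qv pu qu (det D) A ⟩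
    (pu * pv - qu * qv) * det D - pv * A
      ≈⟨ +-cong (*-cong N₀₀ (det-cong (λ i j → Nᵢⱼ i (suc j)))) (-‿cong (begin
           alt (λ j → N zero (suc j) * det (minor N (suc j)))
             ≈⟨ alt-cong (λ j → trans (*-cong (N₀ⱼ j) (det-cong (λ i k → Nᵢⱼ i (punchIn (suc j) k))))
                                      (*-assoc _ _ _)) ⟩
           alt (λ j → pv * (M (suc zero) (suc (suc j)) * det (minor (minor M zero) (suc j))))
             ≈⟨ alt-* {m} _ _ ⟨
           pv * A ∎)) ⟨
    det N ∎
    where
    D : Matrix m
    D i j = M (suc (suc i)) (suc (suc j))
    A : Carrier
    A = alt (λ j → M (suc zero) (suc (suc j)) * det (minor (minor M zero) (suc j)))

open import Data.Bool using (Bool; true; false; _∧_; if_then_else_)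
import Data.Bool.Properties as Bool
import Data.Fin.Properties as Fin
open import Data.Maybe as Maybe using (Maybe; just; nothing)
import Data.Maybe.Properties as Maybe
open import Data.Sum as Sum using (_⊎_; inj₁; inj₂)
import Data.Sum.Properties as Sum
open import Data.Sum.Function.Propositional using (_⊎-↔_)
open import Data.Unit using (⊤; tt)
import Data.Unit.Properties as Unit
open import Function.Bundles using (_↔_; _⇔_; Inverse; mk↔ₛ′; mk⇔)
open import Function.Construct.Composition using (_↔-∘_)
open import Function.Construct.Identity using (↔-id)
open import Function.Construct.Symmetry using (↔-sym)
open import Relation.Binary.Definitions using (DecidableEquality)
open import Relation.Binary.PropositionalEquality using (refl)
open import Relation.Nullary using (¬_; ¬?; does; yes; no; contradiction; _×-dec_)
open import Relation.Nullary.Decidable using (does-⇔; dec-true; dec-false)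

open Inverse using (to; from; strictlyInverseˡ; strictlyInverseʳ)

-- Graphs on arbitrary vertex types and codes for rooted trees

to-injective : ∀ {A B : Set} (f : A ↔ B) {x y} → to f x ≡ to f y → x ≡ y
to-injective f {x} {y} eq =
  ≡.trans (≡.sym (strictlyInverseʳ f x)) (≡.trans (cong (from f) eq) (strictlyInverseʳ f y))

-- Free vertex types let a join live on a sum type and a new leaf on `Maybe`, with no arithmetic on
-- indices. Decidable equality gives the diagonals of matrices and the hairs.
record BoolGraph : Set₁ where
  field
    Vertex : Set
    edge   : Vertex → Vertex → Bool
    _≟_    : DecidableEquality Vertex
open BoolGraph

infix 4 _≃_
_≃_ : BoolGraph → BoolGraph → Set
G ≃ K = Σ (Vertex G ↔ Vertex K) λ f → ∀ u v → edge G u v ≡ edge K (to f u) (to f v)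

≃-sym : ∀ {G K} → G ≃ K → K ≃ G
≃-sym {G} {K} (f , pres) = ↔-sym f , λ u v →
  ≡.sym (≡.trans (pres (from f u) (from f v))
                 (cong₂ (edge K) (strictlyInverseˡ f u) (strictlyInverseˡ f v)))

≃-trans : ∀ {G K L} → G ≃ K → K ≃ L → G ≃ L
≃-trans (f , presf) (g , presg) = (g ↔-∘ f) , λ u v → ≡.trans (presf u v) (presg (to f u) (to f v))

does-≟ : ∀ G K (f : Vertex G ↔ Vertex K) x y →
         does (_≟_ G x y) ≡ does (_≟_ K (to f x) (to f y))
does-≟ G K f x y = does-⇔ (mk⇔ (cong (to f)) (to-injective f)) (_≟_ G x y) (_≟_ K (to f x) (to f y))

-- t ⋈ s hangs s below the root of t.
data BT : Set where
  •   : BT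
  _⋈_ : BT → BT → BT

V : BT → Set
V •       = ⊤
V (t ⋈ s) = V t ⊎ V s

isRoot : ∀ t → V t → Bool
isRoot •       _        = true
isRoot (t ⋈ s) (inj₁ x) = isRoot t x
isRoot (t ⋈ s) (inj₂ y) = false

edgeᵗ : ∀ t → V t → V t → Bool
edgeᵗ •       _        _        = false
edgeᵗ (t ⋈ s) (inj₁ x) (inj₁ y) = edgeᵗ t x y
edgeᵗ (t ⋈ s) (inj₁ x) (inj₂ y) = isRoot t x ∧ isRoot s y
edgeᵗ (t ⋈ s) (inj₂ x) (inj₁ y) = isRoot t y ∧ isRoot s x
edgeᵗ (t ⋈ s) (inj₂ x) (inj₂ y) = edgeᵗ s x y

≟ᵗ : ∀ t → DecidableEquality (V t)
≟ᵗ •       = Unit._≟_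
≟ᵗ (t ⋈ s) = Sum.≡-dec (≟ᵗ t) (≟ᵗ s)

⟦_⟧ : BT → BoolGraph
⟦ t ⟧ = record { Vertex = V t ; edge = edgeᵗ t ; _≟_ = ≟ᵗ t }

size : BT → ℕ
size •       = 1
size (t ⋈ s) = size t ℕ.+ size s

enum : ∀ t → Fin (size t) ↔ V t
enum •       = mk↔ₛ′ (λ _ → tt) (λ _ → zero) (λ _ → refl) (λ { zero → refl })
enum (t ⋈ s) = (enum t ⊎-↔ enum s) ↔-∘ Fin.+↔⊎

-- Isomorphisms of rooted trees

infix 4 _≃ʳ_
_≃ʳ_ : BT → BT → Set
t ≃ʳ s = Σ (V t ↔ V s) λ f → (∀ x y → edgeᵗ t x y ≡ edgeᵗ s (to f x) (to f y))
                           × (∀ x → isRoot t x ≡ isRoot s (to f x))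

≃ʳ⇒≃ : ∀ {t s} → t ≃ʳ s → ⟦ t ⟧ ≃ ⟦ s ⟧
≃ʳ⇒≃ (f , pres , _) = f , pres

≃ʳ-refl : ∀ {t} → t ≃ʳ t
≃ʳ-refl = ↔-id _ , (λ _ _ → refl) , (λ _ → refl)

≃ʳ-trans : ∀ {t s r} → t ≃ʳ s → s ≃ʳ r → t ≃ʳ r
≃ʳ-trans (f , presf , rootf) (g , presg , rootg) =
  (g ↔-∘ f) , (λ x y → ≡.trans (presf x y) (presg _ _)) , (λ x → ≡.trans (rootf x) (rootg _))

⋈-cong : ∀ {t t′ s s′} → t ≃ʳ t′ → s ≃ʳ s′ → t ⋈ s ≃ʳ t′ ⋈ s′
⋈-cong {t} {t′} {s} {s′} (f , presf , rootf) (g , presg , rootg) = (f ⊎-↔ g) , pres , root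
  where
  pres : ∀ x y → edgeᵗ (t ⋈ s) x y ≡ edgeᵗ (t′ ⋈ s′) (to (f ⊎-↔ g) x) (to (f ⊎-↔ g) y)
  pres (inj₁ x) (inj₁ y) = presf x y
  pres (inj₁ x) (inj₂ y) = cong₂ _∧_ (rootf x) (rootg y)
  pres (inj₂ x) (inj₁ y) = cong₂ _∧_ (rootf y) (rootg x)
  pres (inj₂ x) (inj₂ y) = presg x y
  root : ∀ x → isRoot (t ⋈ s) x ≡ isRoot (t′ ⋈ s′) (to (f ⊎-↔ g) x)
  root (inj₁ x) = rootf x
  root (inj₂ x) = refl

-- A code records the order in which subtrees were hung. Exchanging them lets the pendant vertex of
-- the root come before the other subtrees, as it does in a hairing.
⋈-exchange : ∀ t s r → (t ⋈ s) ⋈ r ≃ʳ (t ⋈ r) ⋈ s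
⋈-exchange t s r = mk↔ₛ′ (swap {V t}) (swap {V t}) swap-involutive swap-involutive , pres , root
  where
  swap : ∀ {A B C : Set} → (A ⊎ B) ⊎ C → (A ⊎ C) ⊎ B
  swap (inj₁ (inj₁ x)) = inj₁ (inj₁ x)
  swap (inj₁ (inj₂ y)) = inj₂ y
  swap (inj₂ z)        = inj₁ (inj₂ z)
  swap-involutive : ∀ {A B C : Set} (x : (A ⊎ B) ⊎ C) → swap (swap x) ≡ x
  swap-involutive (inj₁ (inj₁ x)) = refl
  swap-involutive (inj₁ (inj₂ y)) = refl
  swap-involutive (inj₂ z)        = refl
  pres : ∀ x y → edgeᵗ ((t ⋈ s) ⋈ r) x y ≡ edgeᵗ ((t ⋈ r) ⋈ s) (swap x) (swap y)
  pres (inj₁ (inj₁ x)) (inj₁ (inj₁ y)) = refl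
  pres (inj₁ (inj₁ x)) (inj₁ (inj₂ y)) = refl
  pres (inj₁ (inj₁ x)) (inj₂ y)        = refl
  pres (inj₁ (inj₂ x)) (inj₁ (inj₁ y)) = refl
  pres (inj₁ (inj₂ x)) (inj₁ (inj₂ y)) = refl
  pres (inj₁ (inj₂ x)) (inj₂ y)        = refl
  pres (inj₂ x)        (inj₁ (inj₁ y)) = refl
  pres (inj₂ x)        (inj₁ (inj₂ y)) = refl
  pres (inj₂ x)        (inj₂ y)        = refl
  root : ∀ x → isRoot ((t ⋈ s) ⋈ r) x ≡ isRoot ((t ⋈ r) ⋈ s) (swap x)
  root (inj₁ (inj₁ x)) = refl
  root (inj₁ (inj₂ x)) = refl
  root (inj₂ x)        = refl

-- The root passes to the other end of the joining edge, so this isomorphism is one of unrooted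
-- graphs. It serves the case that the upper end of a matched joining edge is the leaf.
⋈-comm : ∀ t s → ⟦ t ⋈ s ⟧ ≃ ⟦ s ⋈ t ⟧
⋈-comm t s = Sum.swap-↔ , pres
  where
  pres : ∀ x y → edgeᵗ (t ⋈ s) x y ≡ edgeᵗ (s ⋈ t) (Sum.swap x) (Sum.swap y)
  pres (inj₁ x) (inj₁ y) = refl
  pres (inj₁ x) (inj₂ y) = Bool.∧-comm (isRoot t x) _
  pres (inj₂ x) (inj₁ y) = Bool.∧-comm (isRoot t y) _
  pres (inj₂ x) (inj₂ y) = refl

-- Hairing

hairGraph : BoolGraph → BoolGraph
hairGraph G = record { Vertex = Vertex G ⊎ Vertex G ; edge = hairEdge ; _≟_ = Sum.≡-dec (_≟_ G) (_≟_ G) }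
  where
  hairEdge : Vertex G ⊎ Vertex G → Vertex G ⊎ Vertex G → Bool
  hairEdge (inj₁ u) (inj₁ v) = edge G u v
  hairEdge (inj₁ u) (inj₂ v) = does (_≟_ G u v)
  hairEdge (inj₂ u) (inj₁ v) = does (_≟_ G u v)
  hairEdge (inj₂ u) (inj₂ v) = false

hairGraph-cong : ∀ {G K} → G ≃ K → hairGraph G ≃ hairGraph K
hairGraph-cong {G} {K} (f , presf) = (f ⊎-↔ f) , pres
  where
  pres : ∀ x y → edge (hairGraph G) x y ≡ edge (hairGraph K) (to (f ⊎-↔ f) x) (to (f ⊎-↔ f) y)
  pres (inj₁ x) (inj₁ y) = presf x y
  pres (inj₁ x) (inj₂ y) = does-≟ G K f x y
  pres (inj₂ x) (inj₁ y) = does-≟ G K f x y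
  pres (inj₂ x) (inj₂ y) = refl

-- Each vertex receives its pendant neighbour before any subtree is hung below it, so hairing
-- commutes with `⋈` and the root remains the old vertex.
hair : BT → BT
hair •       = • ⋈ •
hair (c ⋈ d) = hair c ⋈ hair d

⊎-interchange : ∀ {A B : Set} → ((A ⊎ A) ⊎ (B ⊎ B)) ↔ ((A ⊎ B) ⊎ (A ⊎ B))
⊎-interchange = mk↔ₛ′
  (λ { (inj₁ (inj₁ x)) → inj₁ (inj₁ x) ; (inj₁ (inj₂ x)) → inj₂ (inj₁ x)
     ; (inj₂ (inj₁ x)) → inj₁ (inj₂ x) ; (inj₂ (inj₂ x)) → inj₂ (inj₂ x) })
  (λ { (inj₁ (inj₁ x)) → inj₁ (inj₁ x) ; (inj₁ (inj₂ x)) → inj₂ (inj₁ x)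
     ; (inj₂ (inj₁ x)) → inj₁ (inj₂ x) ; (inj₂ (inj₂ x)) → inj₂ (inj₂ x) })
  (λ { (inj₁ (inj₁ x)) → refl ; (inj₁ (inj₂ x)) → refl
     ; (inj₂ (inj₁ x)) → refl ; (inj₂ (inj₂ x)) → refl })
  (λ { (inj₁ (inj₁ x)) → refl ; (inj₁ (inj₂ x)) → refl
     ; (inj₂ (inj₁ x)) → refl ; (inj₂ (inj₂ x)) → refl })

hair-↔ : ∀ c → V (hair c) ↔ (V c ⊎ V c)
hair-↔ •       = ↔-id _
hair-↔ (c ⋈ d) = ⊎-interchange ↔-∘ (hair-↔ c ⊎-↔ hair-↔ d)

hairRoot : ∀ c → V c ⊎ V c → Bool
hairRoot c = Sum.[ isRoot c , (λ _ → false) ]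

isRoot-hair : ∀ c x → isRoot (hair c) x ≡ hairRoot c (to (hair-↔ c) x)
isRoot-hair •       (inj₁ _) = refl
isRoot-hair •       (inj₂ _) = refl
isRoot-hair (c ⋈ d) (inj₁ x) = ≡.trans (isRoot-hair c x) (lemma (to (hair-↔ c) x))
  where
  lemma : ∀ p → hairRoot c p ≡ hairRoot (c ⋈ d) (to ⊎-interchange (inj₁ p))
  lemma (inj₁ _) = refl
  lemma (inj₂ _) = refl
isRoot-hair (c ⋈ d) (inj₂ x) = lemma (to (hair-↔ d) x)
  where
  lemma : ∀ p → false ≡ hairRoot (c ⋈ d) (to ⊎-interchange (inj₂ p))
  lemma (inj₁ _) = refl
  lemma (inj₂ _) = refl

⟦hair⟧≃hairGraph : ∀ c → ⟦ hair c ⟧ ≃ hairGraph ⟦ c ⟧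
⟦hair⟧≃hairGraph c = hair-↔ c , pres c
  where
  pres : ∀ c x y → edgeᵗ (hair c) x y ≡ edge (hairGraph ⟦ c ⟧) (to (hair-↔ c) x) (to (hair-↔ c) y)
  pres •       (inj₁ _) (inj₁ _) = refl
  pres •       (inj₁ _) (inj₂ _) = refl
  pres •       (inj₂ _) (inj₁ _) = refl
  pres •       (inj₂ _) (inj₂ _) = refl
  pres (c ⋈ d) (inj₁ x) (inj₁ y) = ≡.trans (pres c x y) (lemma (to (hair-↔ c) x) (to (hair-↔ c) y))
    where
    lemma : ∀ p q → edge (hairGraph ⟦ c ⟧) p q
                  ≡ edge (hairGraph ⟦ c ⋈ d ⟧) (to ⊎-interchange (inj₁ p)) (to ⊎-interchange (inj₁ q))
    lemma (inj₁ _) (inj₁ _) = refl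
    lemma (inj₁ _) (inj₂ _) = refl
    lemma (inj₂ _) (inj₁ _) = refl
    lemma (inj₂ _) (inj₂ _) = refl
  pres (c ⋈ d) (inj₂ x) (inj₂ y) = ≡.trans (pres d x y) (lemma (to (hair-↔ d) x) (to (hair-↔ d) y))
    where
    lemma : ∀ p q → edge (hairGraph ⟦ d ⟧) p q
                  ≡ edge (hairGraph ⟦ c ⋈ d ⟧) (to ⊎-interchange (inj₂ p)) (to ⊎-interchange (inj₂ q))
    lemma (inj₁ _) (inj₁ _) = refl
    lemma (inj₁ _) (inj₂ _) = refl
    lemma (inj₂ _) (inj₁ _) = refl
    lemma (inj₂ _) (inj₂ _) = refl
  pres (c ⋈ d) (inj₁ x) (inj₂ y) =
    ≡.trans (cong₂ _∧_ (isRoot-hair c x) (isRoot-hair d y)) (lemma (to (hair-↔ c) x) (to (hair-↔ d) y))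
    where
    lemma : ∀ p q → hairRoot c p ∧ hairRoot d q
                  ≡ edge (hairGraph ⟦ c ⋈ d ⟧) (to ⊎-interchange (inj₁ p)) (to ⊎-interchange (inj₂ q))
    lemma (inj₁ _) (inj₁ _) = refl
    lemma (inj₁ x) (inj₂ _) = Bool.∧-zeroʳ (isRoot c x)
    lemma (inj₂ _) (inj₁ _) = refl
    lemma (inj₂ _) (inj₂ _) = refl
  pres (c ⋈ d) (inj₂ x) (inj₁ y) =
    ≡.trans (cong₂ _∧_ (isRoot-hair c y) (isRoot-hair d x)) (lemma (to (hair-↔ d) x) (to (hair-↔ c) y))
    where
    lemma : ∀ p q → hairRoot c q ∧ hairRoot d p
                  ≡ edge (hairGraph ⟦ c ⋈ d ⟧) (to ⊎-interchange (inj₂ p)) (to ⊎-interchange (inj₁ q))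
    lemma (inj₁ _) (inj₁ _) = refl
    lemma (inj₁ _) (inj₂ _) = refl
    lemma (inj₂ _) (inj₁ y) = Bool.∧-zeroʳ (isRoot c y)
    lemma (inj₂ _) (inj₂ _) = refl

-- Adding a leaf

addLeafGraph : (G : BoolGraph) → Vertex G → BoolGraph
addLeafGraph G u = record { Vertex = Maybe (Vertex G) ; edge = leafEdge ; _≟_ = Maybe.≡-dec (_≟_ G) }
  where
  leafEdge : Maybe (Vertex G) → Maybe (Vertex G) → Bool
  leafEdge nothing  nothing  = false
  leafEdge nothing  (just v) = does (_≟_ G u v)
  leafEdge (just v) nothing  = does (_≟_ G u v)
  leafEdge (just v) (just w) = edge G v w

Maybe-↔ : ∀ {A B : Set} → A ↔ B → Maybe A ↔ Maybe B
Maybe-↔ f = mk↔ₛ′ (Maybe.map (to f)) (Maybe.map (from f))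
  (λ { nothing → refl ; (just x) → cong just (strictlyInverseˡ f x) })
  (λ { nothing → refl ; (just x) → cong just (strictlyInverseʳ f x) })

addLeafGraph-cong : ∀ {G K} (f : G ≃ K) u → addLeafGraph G u ≃ addLeafGraph K (to (proj₁ f) u)
addLeafGraph-cong {G} {K} (f , presf) u = Maybe-↔ f , pres
  where
  pres : ∀ x y → edge (addLeafGraph G u) x y
               ≡ edge (addLeafGraph K (to f u)) (Maybe.map (to f) x) (Maybe.map (to f) y)
  pres nothing  nothing  = refl
  pres nothing  (just v) = does-≟ G K f u v
  pres (just v) nothing  = does-≟ G K f u v
  pres (just v) (just w) = presf v w

addLeaf : ∀ t → V t → BT
addLeaf •       _        = • ⋈ •
addLeaf (t ⋈ s) (inj₁ x) = addLeaf t x ⋈ s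
addLeaf (t ⋈ s) (inj₂ x) = t ⋈ addLeaf s x

⊎-maybeˡ : ∀ {A B : Set} → (Maybe A ⊎ B) ↔ Maybe (A ⊎ B)
⊎-maybeˡ = mk↔ₛ′
  (λ { (inj₁ nothing) → nothing ; (inj₁ (just x)) → just (inj₁ x) ; (inj₂ y) → just (inj₂ y) })
  (λ { nothing → inj₁ nothing ; (just (inj₁ x)) → inj₁ (just x) ; (just (inj₂ y)) → inj₂ y })
  (λ { nothing → refl ; (just (inj₁ x)) → refl ; (just (inj₂ y)) → refl })
  (λ { (inj₁ nothing) → refl ; (inj₁ (just x)) → refl ; (inj₂ y) → refl })

⊎-maybeʳ : ∀ {A B : Set} → (A ⊎ Maybe B) ↔ Maybe (A ⊎ B)
⊎-maybeʳ = mk↔ₛ′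
  (λ { (inj₁ x) → just (inj₁ x) ; (inj₂ nothing) → nothing ; (inj₂ (just y)) → just (inj₂ y) })
  (λ { nothing → inj₂ nothing ; (just (inj₁ x)) → inj₁ x ; (just (inj₂ y)) → inj₂ (just y) })
  (λ { nothing → refl ; (just (inj₁ x)) → refl ; (just (inj₂ y)) → refl })
  (λ { (inj₁ x) → refl ; (inj₂ nothing) → refl ; (inj₂ (just y)) → refl })

⊤⊎⊤↔Maybe⊤ : (⊤ ⊎ ⊤) ↔ Maybe ⊤
⊤⊎⊤↔Maybe⊤ = mk↔ₛ′
  (λ { (inj₁ _) → just tt ; (inj₂ _) → nothing })
  (λ { (just _) → inj₁ tt ; nothing → inj₂ tt })
  (λ { (just _) → refl ; nothing → refl })
  (λ { (inj₁ _) → refl ; (inj₂ _) → refl })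

addLeaf-↔ : ∀ t x → V (addLeaf t x) ↔ Maybe (V t)
addLeaf-↔ •       _        = ⊤⊎⊤↔Maybe⊤
addLeaf-↔ (t ⋈ s) (inj₁ x) = ⊎-maybeˡ ↔-∘ (addLeaf-↔ t x ⊎-↔ ↔-id _)
addLeaf-↔ (t ⋈ s) (inj₂ x) = ⊎-maybeʳ ↔-∘ (↔-id _ ⊎-↔ addLeaf-↔ s x)

leafRoot : ∀ t → Maybe (V t) → Bool
leafRoot t = Maybe.maybe (isRoot t) false

isRoot-addLeaf : ∀ t x y → isRoot (addLeaf t x) y ≡ leafRoot t (to (addLeaf-↔ t x) y)
isRoot-addLeaf •       _        (inj₁ _) = refl
isRoot-addLeaf •       _        (inj₂ _) = refl
isRoot-addLeaf (t ⋈ s) (inj₁ x) (inj₂ y) = refl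
isRoot-addLeaf (t ⋈ s) (inj₂ x) (inj₁ y) = refl
isRoot-addLeaf (t ⋈ s) (inj₁ x) (inj₁ y) = ≡.trans (isRoot-addLeaf t x y) (lemma (to (addLeaf-↔ t x) y))
  where
  lemma : ∀ p → leafRoot t p ≡ leafRoot (t ⋈ s) (to ⊎-maybeˡ (inj₁ p))
  lemma nothing  = refl
  lemma (just _) = refl
isRoot-addLeaf (t ⋈ s) (inj₂ x) (inj₂ y) = lemma (to (addLeaf-↔ s x) y)
  where
  lemma : ∀ p → false ≡ leafRoot (t ⋈ s) (to ⊎-maybeʳ (inj₂ p))
  lemma nothing  = refl
  lemma (just _) = refl

addLeaf-≃ : ∀ t x → ⟦ addLeaf t x ⟧ ≃ addLeafGraph ⟦ t ⟧ x
addLeaf-≃ t x = addLeaf-↔ t x , pres t x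
  where
  pres : ∀ t x y z → edgeᵗ (addLeaf t x) y z
                   ≡ edge (addLeafGraph ⟦ t ⟧ x) (to (addLeaf-↔ t x) y) (to (addLeaf-↔ t x) z)
  pres •       _        (inj₁ _) (inj₁ _) = refl
  pres •       _        (inj₁ _) (inj₂ _) = refl
  pres •       _        (inj₂ _) (inj₁ _) = refl
  pres •       _        (inj₂ _) (inj₂ _) = refl
  pres (t ⋈ s) (inj₁ x) (inj₁ y) (inj₁ z) =
    ≡.trans (pres t x y z) (lemma (to (addLeaf-↔ t x) y) (to (addLeaf-↔ t x) z))
    where
    lemma : ∀ p q → edge (addLeafGraph ⟦ t ⟧ x) p q
      ≡ edge (addLeafGraph ⟦ t ⋈ s ⟧ (inj₁ x)) (to ⊎-maybeˡ (inj₁ p)) (to ⊎-maybeˡ (inj₁ q))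
    lemma nothing  nothing  = refl
    lemma nothing  (just _) = refl
    lemma (just _) nothing  = refl
    lemma (just _) (just _) = refl
  pres (t ⋈ s) (inj₁ x) (inj₁ y) (inj₂ z) =
    ≡.trans (cong (_∧ isRoot s z) (isRoot-addLeaf t x y)) (lemma (to (addLeaf-↔ t x) y))
    where
    lemma : ∀ p → leafRoot t p ∧ isRoot s z
      ≡ edge (addLeafGraph ⟦ t ⋈ s ⟧ (inj₁ x)) (to ⊎-maybeˡ (inj₁ p)) (just (inj₂ z))
    lemma nothing  = refl
    lemma (just _) = refl
  pres (t ⋈ s) (inj₁ x) (inj₂ y) (inj₁ z) =
    ≡.trans (cong (_∧ isRoot s y) (isRoot-addLeaf t x z)) (lemma (to (addLeaf-↔ t x) z))
    where
    lemma : ∀ p → leafRoot t p ∧ isRoot s y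
      ≡ edge (addLeafGraph ⟦ t ⋈ s ⟧ (inj₁ x)) (just (inj₂ y)) (to ⊎-maybeˡ (inj₁ p))
    lemma nothing  = refl
    lemma (just _) = refl
  pres (t ⋈ s) (inj₁ x) (inj₂ y) (inj₂ z) = refl
  pres (t ⋈ s) (inj₂ x) (inj₁ y) (inj₁ z) = refl
  pres (t ⋈ s) (inj₂ x) (inj₁ y) (inj₂ z) =
    ≡.trans (cong (isRoot t y ∧_) (isRoot-addLeaf s x z)) (lemma (to (addLeaf-↔ s x) z))
    where
    lemma : ∀ p → isRoot t y ∧ leafRoot s p
      ≡ edge (addLeafGraph ⟦ t ⋈ s ⟧ (inj₂ x)) (just (inj₁ y)) (to ⊎-maybeʳ (inj₂ p))
    lemma nothing  = Bool.∧-zeroʳ (isRoot t y)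
    lemma (just _) = refl
  pres (t ⋈ s) (inj₂ x) (inj₂ y) (inj₁ z) =
    ≡.trans (cong (isRoot t z ∧_) (isRoot-addLeaf s x y)) (lemma (to (addLeaf-↔ s x) y))
    where
    lemma : ∀ p → isRoot t z ∧ leafRoot s p
      ≡ edge (addLeafGraph ⟦ t ⋈ s ⟧ (inj₂ x)) (to ⊎-maybeʳ (inj₂ p)) (just (inj₁ z))
    lemma nothing  = Bool.∧-zeroʳ (isRoot t z)
    lemma (just _) = refl
  pres (t ⋈ s) (inj₂ x) (inj₂ y) (inj₂ z) =
    ≡.trans (pres s x y z) (lemma (to (addLeaf-↔ s x) y) (to (addLeaf-↔ s x) z))
    where
    lemma : ∀ p q → edge (addLeafGraph ⟦ s ⟧ x) p q
      ≡ edge (addLeafGraph ⟦ t ⋈ s ⟧ (inj₂ x)) (to ⊎-maybeʳ (inj₂ p)) (to ⊎-maybeʳ (inj₂ q))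
    lemma nothing  nothing  = refl
    lemma nothing  (just _) = refl
    lemma (just _) nothing  = refl
    lemma (just _) (just _) = refl

-- Induction along `⋈` offers no single vertex to eliminate from the determinant; growth by leaves
-- does.
data Built : BT → Set where
  single : Built •
  grow   : ∀ {t} → Built t → ∀ x → Built (addLeaf t x)

built-⋈ : ∀ {t s} → Built t → Built s → Built (t ⋈ s)
built-⋈ single     single     = grow single tt
built-⋈ single     (grow b y) = grow (built-⋈ single b) (inj₂ y)
built-⋈ (grow a x) b          = grow (built-⋈ a b) (inj₁ x)

built : ∀ t → Built t
built •       = single
built (t ⋈ s) = built-⋈ (built t) (built s)

↔Maybe : ∀ {k} {A : Set} → Fin k ↔ A → Fin (suc k) ↔ Maybe A
↔Maybe e = mk↔ₛ′
  (λ { zero → nothing ; (suc i) → just (to e i) })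
  (λ { nothing → zero ; (just x) → suc (from e x) })
  (λ { nothing → refl ; (just x) → cong just (strictlyInverseˡ e x) })
  (λ { zero → refl ; (suc i) → cong suc (strictlyInverseʳ e i) })

-- Elimination acts on the leading indices, so the neighbour of the removed leaf has to be listed
-- first.
enumFrom : ∀ t x → Σ ℕ λ m → Σ (Fin (suc m) ↔ V t) λ e → to e zero ≡ x
enumFrom t x = pointed (enum t)
  where
  pointed : ∀ {k} → Fin k ↔ V t → Σ ℕ λ m → Σ (Fin (suc m) ↔ V t) λ e → to e zero ≡ x
  pointed {zero}  e with () ← from e x
  pointed {suc m} e = m , (e ↔-∘ Perm.transpose zero (from e x)) , strictlyInverseˡ e x

-- Determinants of weighted trees

module WeightedTrees {c ℓ} (R : CommutativeRing c ℓ) where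
  open CommutativeRing R hiding (zero) renaming (refl to ≈-refl)
  open import Relation.Binary.Reasoning.Setoid setoid
  open Determinant R
  open import Algebra.Properties.Ring (CommutativeRing.ring R) using (-‿distribʳ-*)

  Weight : Set c
  Weight = Carrier × Carrier

  -- With weights (λ, 1) on all vertices, fold t consists of the characteristic polynomials of t and of
  -- t minus its root.
  infixl 7 _⊙_
  _⊙_ : Weight → Weight → Weight
  (p , q) ⊙ (p′ , q′) = p * p′ - q * q′ , q * p′

  fold : ∀ t → (V t → Weight) → Weight
  fold •       w = w tt
  fold (t ⋈ s) w = fold t (w ∘ inj₁) ⊙ fold s (w ∘ inj₂)

  fold-cong : ∀ t {w w′ : V t → Weight} → (∀ x → w x ≡ w′ x) → fold t w ≡ fold t w′
  fold-cong •       w≗w′ = w≗w′ tt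
  fold-cong (t ⋈ s) w≗w′ = cong₂ _⊙_ (fold-cong t (w≗w′ ∘ inj₁)) (fold-cong s (w≗w′ ∘ inj₂))

  absorb : ∀ G → Vertex G → (Maybe (Vertex G) → Weight) → Vertex G → Weight
  absorb G u w v = if does (_≟_ G u v) then w (just v) ⊙ w nothing else w (just v)

  -- At the occurrence `x` the new edge folds to a single `⊙`, just what eliminating the leaf leaves
  -- on its neighbour. Hence `fold` follows the determinant through every elimination.
  fold-addLeaf : ∀ t x (w : Maybe (V t) → Weight) →
                 fold (addLeaf t x) (w ∘ to (addLeaf-↔ t x)) ≡ fold t (absorb ⟦ t ⟧ x w)
  fold-addLeaf •       _        w = refl
  fold-addLeaf (t ⋈ s) (inj₁ x) w = cong (_⊙ fold s (w ∘ just ∘ inj₂)) (fold-addLeaf t x (w ∘ to ⊎-maybeˡ ∘ inj₁))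
  fold-addLeaf (t ⋈ s) (inj₂ x) w = cong (fold t (w ∘ just ∘ inj₁) ⊙_) (fold-addLeaf s x (w ∘ to ⊎-maybeʳ ∘ inj₂))

  -- Row u is scaled by the second weight of u, so that weights behave like fractions p / q on the
  -- diagonal and eliminating a leaf needs no division.
  weightMatrix : ∀ G → (Vertex G → Weight) → Vertex G → Vertex G → Carrier
  weightMatrix G w u v =
    if does (_≟_ G u v) then proj₁ (w u) else (if edge G u v then - proj₂ (w u) else 0#)

  weightMatrix-≃ : ∀ {G K} (f : G ≃ K) (w : Vertex K → Weight) u v →
    weightMatrix G (w ∘ to (proj₁ f)) u v ≡ weightMatrix K w (to (proj₁ f) u) (to (proj₁ f) v)
  weightMatrix-≃ {G} {K} (f , pres) w u v = cong₂ (λ b b′ →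
    if b then proj₁ (w (to f u)) else (if b′ then - proj₂ (w (to f u)) else 0#)) (does-≟ G K f u v) (pres u v)

  det-reindex : ∀ {A : Set} {k l} (e : Fin k ↔ A) (e′ : Fin l ↔ A) (M : A → A → Carrier) →
                det (λ i j → M (to e i) (to e j)) ≈ det (λ i j → M (to e′ i) (to e′ j))
  det-reindex {k = k} e e′ M with Perm.↔⇒≡ (↔-sym e′ ↔-∘ e)
  ... | refl = begin
    det (λ i j → M (to e i) (to e j))
      ≈⟨ det-cong {k} (λ i j → reflexive
           (cong₂ M (≡.sym (strictlyInverseˡ e′ (to e i))) (≡.sym (strictlyInverseˡ e′ (to e j))))) ⟩
    det (λ i j → M (to e′ (from e′ (to e i))) (to e′ (from e′ (to e j))))
      ≈⟨ det-permute (↔-sym e′ ↔-∘ e) (λ i j → M (to e′ i) (to e′ j)) ⟩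
    det (λ i j → M (to e′ i) (to e′ j)) ∎

  det-absorb : ∀ G {m} (e : Fin (suc m) ↔ Vertex G) (w : Maybe (Vertex G) → Weight) →
    let u = to e zero in
    det (λ i j → weightMatrix (addLeafGraph G u) w (to (↔Maybe e) i) (to (↔Maybe e) j))
      ≈ det (λ i j → weightMatrix G (absorb G u w) (to e i) (to e j))
  det-absorb G {m} e w = det-eliminate pv qv pu qu M N ≈-refl M₀₁ M₀ⱼ M₁₀ Mᵢ₀ M₁₁ N₀₀ N₀ⱼ Nᵢⱼ
    where
    u : Vertex G
    u = to e zero
    pv qv pu qu : Carrier
    pv = proj₁ (w nothing)
    qv = proj₂ (w nothing)
    pu = proj₁ (w (just u))
    qu = proj₂ (w (just u))
    M : Matrix (suc (suc m))
    M i j = weightMatrix (addLeafGraph G u) w (to (↔Maybe e) i) (to (↔Maybe e) j)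
    N : Matrix (suc m)
    N i j = weightMatrix G (absorb G u w) (to e i) (to e j)
    u≟u : does (_≟_ G u u) ≡ true
    u≟u = dec-true (_≟_ G u u) refl
    u≟ : ∀ j → does (_≟_ G u (to e (suc j))) ≡ false
    u≟ j = dec-false (_≟_ G u (to e (suc j))) (λ eq → Fin.0≢1+n (to-injective e eq))
    M₀₁ : M zero (suc zero) ≈ - qv
    M₀₁ rewrite u≟u = ≈-refl
    M₀ⱼ : ∀ j → M zero (suc (suc j)) ≈ 0#
    M₀ⱼ j rewrite u≟ j = ≈-refl
    M₁₀ : M (suc zero) zero ≈ - qu
    M₁₀ rewrite u≟u = ≈-refl
    Mᵢ₀ : ∀ i → M (suc (suc i)) zero ≈ 0#
    Mᵢ₀ i rewrite u≟ i = ≈-refl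
    M₁₁ : M (suc zero) (suc zero) ≈ pu
    M₁₁ rewrite u≟u = ≈-refl
    N₀₀ : N zero zero ≈ pu * pv - qu * qv
    N₀₀ rewrite u≟u = ≈-refl
    -- The new denominator at the neighbour is `qu * pv`, so off the diagonal its row is `pv` times
    -- the old one.
    N₀ⱼ : ∀ j → N zero (suc j) ≈ pv * M (suc zero) (suc (suc j))
    N₀ⱼ j rewrite u≟ j | u≟u with edge G u (to e (suc j))
    ... | true  = trans (-‿cong (*-comm qu pv)) (-‿distribʳ-* pv qu)
    ... | false = sym (zeroʳ pv)
    Nᵢⱼ : ∀ i j → N (suc i) j ≈ M (suc (suc i)) (suc j)
    Nᵢⱼ i j rewrite u≟ i = ≈-refl

  -- The weights are quantified inside the induction because the hypothesis is applied to absorbed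
  -- weights, which differ from vertex to vertex even if `w` is constant.
  det-tree′ : ∀ {t} → Built t → ∀ {k} (e : Fin k ↔ V t) (w : V t → Weight) →
              det (λ i j → weightMatrix ⟦ t ⟧ w (to e i) (to e j)) ≈ proj₁ (fold t w)
  det-tree′ single e w = trans (det-reindex e (enum •) (weightMatrix ⟦ • ⟧ w))
    (trans (+-congˡ (trans (sym (+-identityˡ _)) (-‿inverseʳ 0#))) (trans (+-identityʳ _) (*-identityʳ _)))
  det-tree′ (grow {t} b x) e w with enumFrom t x
  ... | m , e₁ , refl = begin
    det (λ i j → weightMatrix ⟦ addLeaf t x₁ ⟧ w (to e i) (to e j))
      ≈⟨ det-reindex e (↔-sym φ ↔-∘ ↔Maybe e₁) (weightMatrix ⟦ addLeaf t x₁ ⟧ w) ⟩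
    det (λ i j → weightMatrix ⟦ addLeaf t x₁ ⟧ w (from φ (to (↔Maybe e₁) i)) (from φ (to (↔Maybe e₁) j)))
      ≈⟨ det-cong {suc (suc m)} (λ i j → reflexive (weightMatrix-≃ {addLeafGraph ⟦ t ⟧ x₁} {⟦ addLeaf t x₁ ⟧}
           (≃-sym {⟦ addLeaf t x₁ ⟧} {addLeafGraph ⟦ t ⟧ x₁} (addLeaf-≃ t x₁)) w
           (to (↔Maybe e₁) i) (to (↔Maybe e₁) j))) ⟨
    det (λ i j → weightMatrix (addLeafGraph ⟦ t ⟧ x₁) (w ∘ from φ) (to (↔Maybe e₁) i) (to (↔Maybe e₁) j))
      ≈⟨ det-absorb ⟦ t ⟧ e₁ (w ∘ from φ) ⟩
    det (λ i j → weightMatrix ⟦ t ⟧ (absorb ⟦ t ⟧ x₁ (w ∘ from φ)) (to e₁ i) (to e₁ j))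
      ≈⟨ det-tree′ b e₁ (absorb ⟦ t ⟧ x₁ (w ∘ from φ)) ⟩
    proj₁ (fold t (absorb ⟦ t ⟧ x₁ (w ∘ from φ)))
      ≡⟨ cong proj₁ (fold-addLeaf t x₁ (w ∘ from φ)) ⟨
    proj₁ (fold (addLeaf t x₁) (w ∘ from φ ∘ to φ))
      ≡⟨ cong proj₁ (fold-cong (addLeaf t x₁) (λ y → cong w (strictlyInverseʳ φ y))) ⟩
    proj₁ (fold (addLeaf t x₁) w) ∎
    where
    x₁ : V t
    x₁ = to e₁ zero
    φ : V (addLeaf t x₁) ↔ Maybe (V t)
    φ = addLeaf-↔ t x₁

  det-tree : ∀ t {k} (e : Fin k ↔ V t) (w : V t → Weight) →
             det (λ i j → weightMatrix ⟦ t ⟧ w (to e i) (to e j)) ≈ proj₁ (fold t w)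
  det-tree t = det-tree′ (built t)

open import Defs
open import Data.Empty using (⊥-elim)
open import Data.Integer as ℤ using (ℤ; +_; -_; _+_; _*_; _-_)
import Data.Integer.Properties as ℤ
import Data.Integer.Tactic.RingSolver as ℤ-Solver
open import Data.List using (List; []; _∷_; _++_; length; map; lookup)
import Data.List.Properties as List
open import Data.List.Membership.DecPropositional using (_∈?_)
open import Data.List.Membership.Propositional.Properties using (∈-∃++; ∈-lookup)
open import Data.List.Relation.Unary.All as All using ([]; _∷_)
import Data.List.Relation.Unary.All.Properties as All
open import Data.List.Relation.Unary.AllPairs using ([]; _∷_)
open import Data.List.Relation.Unary.Any using (here; there)
open import Data.List.Relation.Unary.Linked as Linked using (Linked; [-]; _∷_)
import Data.List.Relation.Unary.Linked.Properties as Linked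
open import Data.List.Relation.Unary.Unique.Propositional using (Unique)
import Data.List.Relation.Unary.Unique.Propositional.Properties as Unique
open import Data.Nat.Divisibility using (_∣_; divides; _∣?_; ∣m∣n⇒∣m+n; ∣-refl; _∣0)
import Data.Nat.Properties as ℕ
import Data.Nat.Tactic.RingSolver as ℕ-Solver
open import Level using (0ℓ)
open import Relation.Binary.Construct.Closure.ReflexiveTransitive as Star using (Star; ε; _◅_; _◅◅_)

open ≡-Reasoning

-- The ring of integer polynomials

infix 4 _≐_
-- Coefficient lists may end in zeros, so some ring laws hold for the coefficients but not for the
-- lists.
_≐_ : Poly → Poly → Set
p ≐ q = ∀ k → coeff p k ≡ coeff q k

coeff-⊕ : ∀ p q k → coeff (p ⊕ q) k ≡ coeff p k ℤ.+ coeff q k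
coeff-⊕ []      q       k       = ≡.sym (ℤ.+-identityˡ _)
coeff-⊕ (x ∷ p) []      k       = ≡.sym (ℤ.+-identityʳ _)
coeff-⊕ (x ∷ p) (y ∷ q) zero    = refl
coeff-⊕ (x ∷ p) (y ∷ q) (suc k) = coeff-⊕ p q k

coeff-scale : ∀ c p k → coeff (scale c p) k ≡ c ℤ.* coeff p k
coeff-scale c []      k       = ≡.sym (ℤ.*-zeroʳ c)
coeff-scale c (x ∷ p) zero    = refl
coeff-scale c (x ∷ p) (suc k) = coeff-scale c p k

coeff-∷⊗-0 : ∀ x p q → coeff ((x ∷ p) ⊗ q) 0 ≡ x ℤ.* coeff q 0
coeff-∷⊗-0 x p q = begin
  coeff ((x ∷ p) ⊗ q) 0              ≡⟨ coeff-⊕ (scale x q) _ 0 ⟩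
  coeff (scale x q) 0 ℤ.+ + 0        ≡⟨ ℤ.+-identityʳ _ ⟩
  coeff (scale x q) 0                ≡⟨ coeff-scale x q 0 ⟩
  x ℤ.* coeff q 0                    ∎

coeff-∷⊗-suc : ∀ x p q k → coeff ((x ∷ p) ⊗ q) (suc k) ≡ x ℤ.* coeff q (suc k) ℤ.+ coeff (p ⊗ q) k
coeff-∷⊗-suc x p q k = ≡.trans (coeff-⊕ (scale x q) _ (suc k)) (cong (ℤ._+ coeff (p ⊗ q) k) (coeff-scale x q (suc k)))

⊗-[] : ∀ p → p ⊗ [] ≐ []
⊗-[] []      k       = refl
⊗-[] (x ∷ p) zero    = refl
⊗-[] (x ∷ p) (suc k) = ⊗-[] p k

-- The product recurses on its left factor; this mirrored recursion on the right factor yields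
-- commutativity.
coeff-⊗∷-suc : ∀ p y q k → coeff (p ⊗ (y ∷ q)) (suc k) ≡ y ℤ.* coeff p (suc k) ℤ.+ coeff (p ⊗ q) k
coeff-⊗∷-suc []      y q k       = ≡.sym (≡.trans (ℤ.+-identityʳ _) (ℤ.*-zeroʳ y))
coeff-⊗∷-suc (x ∷ p) y q zero    = begin
  coeff ((x ∷ p) ⊗ (y ∷ q)) 1                                 ≡⟨ coeff-∷⊗-suc x p (y ∷ q) 0 ⟩
  x ℤ.* coeff q 0 ℤ.+ coeff (p ⊗ (y ∷ q)) 0                   ≡⟨ cong (λ z → x ℤ.* coeff q 0 ℤ.+ z) (lemma p) ⟩
  x ℤ.* coeff q 0 ℤ.+ y ℤ.* coeff p 0                         ≡⟨ ℤ.+-comm (x ℤ.* coeff q 0) _ ⟩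
  y ℤ.* coeff p 0 ℤ.+ x ℤ.* coeff q 0                         ≡⟨ cong (λ z → y ℤ.* coeff p 0 ℤ.+ z) (coeff-∷⊗-0 x p q) ⟨
  y ℤ.* coeff p 0 ℤ.+ coeff ((x ∷ p) ⊗ q) 0                   ∎
  where
  lemma : ∀ p → coeff (p ⊗ (y ∷ q)) 0 ≡ y ℤ.* coeff p 0
  lemma []      = ≡.sym (ℤ.*-zeroʳ y)
  lemma (x ∷ p) = ≡.trans (coeff-∷⊗-0 x p (y ∷ q)) (ℤ.*-comm x y)
coeff-⊗∷-suc (x ∷ p) y q (suc k) = begin
  coeff ((x ∷ p) ⊗ (y ∷ q)) (suc (suc k))
    ≡⟨ coeff-∷⊗-suc x p (y ∷ q) (suc k) ⟩
  x ℤ.* coeff q (suc k) ℤ.+ coeff (p ⊗ (y ∷ q)) (suc k)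
    ≡⟨ cong (λ z → x ℤ.* coeff q (suc k) ℤ.+ z) (coeff-⊗∷-suc p y q k) ⟩
  x ℤ.* coeff q (suc k) ℤ.+ (y ℤ.* coeff p (suc k) ℤ.+ coeff (p ⊗ q) k)
    ≡⟨ exchange (x ℤ.* coeff q (suc k)) (y ℤ.* coeff p (suc k)) (coeff (p ⊗ q) k) ⟩
  y ℤ.* coeff p (suc k) ℤ.+ (x ℤ.* coeff q (suc k) ℤ.+ coeff (p ⊗ q) k)
    ≡⟨ cong (λ z → y ℤ.* coeff p (suc k) ℤ.+ z) (coeff-∷⊗-suc x p q k) ⟨
  y ℤ.* coeff p (suc k) ℤ.+ coeff ((x ∷ p) ⊗ q) (suc k) ∎
  where
  exchange : ∀ a b c → a ℤ.+ (b ℤ.+ c) ≡ b ℤ.+ (a ℤ.+ c)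
  exchange = ℤ-Solver.solve-∀

⊗-comm : ∀ p q → p ⊗ q ≐ q ⊗ p
⊗-comm []      q k       = ≡.sym (⊗-[] q k)
⊗-comm (x ∷ p) [] k       = ⊗-[] (x ∷ p) k
⊗-comm (x ∷ p) (y ∷ q) zero    = begin
  coeff ((x ∷ p) ⊗ (y ∷ q)) 0 ≡⟨ coeff-∷⊗-0 x p (y ∷ q) ⟩
  x ℤ.* y                     ≡⟨ ℤ.*-comm x y ⟩
  y ℤ.* x                     ≡⟨ coeff-∷⊗-0 y q (x ∷ p) ⟨
  coeff ((y ∷ q) ⊗ (x ∷ p)) 0 ∎
⊗-comm (x ∷ p) (y ∷ q) (suc k) = begin
  coeff ((x ∷ p) ⊗ (y ∷ q)) (suc k)                 ≡⟨ coeff-∷⊗-suc x p (y ∷ q) k ⟩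
  x ℤ.* coeff q k ℤ.+ coeff (p ⊗ (y ∷ q)) k         ≡⟨ cong (λ z → x ℤ.* coeff q k ℤ.+ z) (⊗-comm p (y ∷ q) k) ⟩
  x ℤ.* coeff q k ℤ.+ coeff ((y ∷ q) ⊗ p) k         ≡⟨ coeff-⊗∷-suc (y ∷ q) x p k ⟨
  coeff ((y ∷ q) ⊗ (x ∷ p)) (suc k)                 ∎

⊗-congˡ : ∀ p {q q′} → q ≐ q′ → p ⊗ q ≐ p ⊗ q′
⊗-congˡ []      q≈q′ k = refl
⊗-congˡ (x ∷ p) {q} {q′} q≈q′ zero    = begin
  coeff ((x ∷ p) ⊗ q) 0  ≡⟨ coeff-∷⊗-0 x p q ⟩
  x ℤ.* coeff q 0        ≡⟨ cong (x ℤ.*_) (q≈q′ 0) ⟩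
  x ℤ.* coeff q′ 0       ≡⟨ coeff-∷⊗-0 x p q′ ⟨
  coeff ((x ∷ p) ⊗ q′) 0 ∎
⊗-congˡ (x ∷ p) {q} {q′} q≈q′ (suc k) = begin
  coeff ((x ∷ p) ⊗ q) (suc k)                    ≡⟨ coeff-∷⊗-suc x p q k ⟩
  x ℤ.* coeff q (suc k) ℤ.+ coeff (p ⊗ q) k      ≡⟨ cong₂ ℤ._+_ (cong (x ℤ.*_) (q≈q′ (suc k))) (⊗-congˡ p q≈q′ k) ⟩
  x ℤ.* coeff q′ (suc k) ℤ.+ coeff (p ⊗ q′) k    ≡⟨ coeff-∷⊗-suc x p q′ k ⟨
  coeff ((x ∷ p) ⊗ q′) (suc k)                   ∎

⊗-cong : ∀ {p p′ q q′} → p ≐ p′ → q ≐ q′ → p ⊗ q ≐ p′ ⊗ q′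
⊗-cong {p} {p′} {q} {q′} p≈p′ q≈q′ k = begin
  coeff (p ⊗ q) k   ≡⟨ ⊗-congˡ p q≈q′ k ⟩
  coeff (p ⊗ q′) k  ≡⟨ ⊗-comm p q′ k ⟩
  coeff (q′ ⊗ p) k  ≡⟨ ⊗-congˡ q′ p≈p′ k ⟩
  coeff (q′ ⊗ p′) k ≡⟨ ⊗-comm q′ p′ k ⟩
  coeff (p′ ⊗ q′) k ∎

⊗-scale : ∀ c p q → scale c p ⊗ q ≐ scale c (p ⊗ q)
⊗-scale c []      q k = refl
⊗-scale c (x ∷ p) q zero    = begin
  coeff (scale c (x ∷ p) ⊗ q) 0    ≡⟨ coeff-∷⊗-0 (c ℤ.* x) (scale c p) q ⟩
  c ℤ.* x ℤ.* coeff q 0            ≡⟨ ℤ.*-assoc c x _ ⟩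
  c ℤ.* (x ℤ.* coeff q 0)          ≡⟨ cong (c ℤ.*_) (coeff-∷⊗-0 x p q) ⟨
  c ℤ.* coeff ((x ∷ p) ⊗ q) 0      ≡⟨ coeff-scale c ((x ∷ p) ⊗ q) 0 ⟨
  coeff (scale c ((x ∷ p) ⊗ q)) 0  ∎
⊗-scale c (x ∷ p) q (suc k) = begin
  coeff (scale c (x ∷ p) ⊗ q) (suc k)
    ≡⟨ coeff-∷⊗-suc (c ℤ.* x) (scale c p) q k ⟩
  c ℤ.* x ℤ.* coeff q (suc k) ℤ.+ coeff (scale c p ⊗ q) k
    ≡⟨ cong (λ z → c ℤ.* x ℤ.* coeff q (suc k) ℤ.+ z) (≡.trans (⊗-scale c p q k) (coeff-scale c (p ⊗ q) k)) ⟩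
  c ℤ.* x ℤ.* coeff q (suc k) ℤ.+ c ℤ.* coeff (p ⊗ q) k
    ≡⟨ factor c x _ _ ⟩
  c ℤ.* (x ℤ.* coeff q (suc k) ℤ.+ coeff (p ⊗ q) k)
    ≡⟨ cong (c ℤ.*_) (coeff-∷⊗-suc x p q k) ⟨
  c ℤ.* coeff ((x ∷ p) ⊗ q) (suc k)
    ≡⟨ coeff-scale c ((x ∷ p) ⊗ q) (suc k) ⟨
  coeff (scale c ((x ∷ p) ⊗ q)) (suc k) ∎
  where
  factor : ∀ c x a b → c ℤ.* x ℤ.* a ℤ.+ c ℤ.* b ≡ c ℤ.* (x ℤ.* a ℤ.+ b)
  factor = ℤ-Solver.solve-∀

⊗-distribˡ : ∀ p q r → p ⊗ (q ⊕ r) ≐ (p ⊗ q) ⊕ (p ⊗ r)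
⊗-distribˡ []      q r k = refl
⊗-distribˡ (x ∷ p) q r zero    = begin
  coeff ((x ∷ p) ⊗ (q ⊕ r)) 0              ≡⟨ coeff-∷⊗-0 x p (q ⊕ r) ⟩
  x ℤ.* coeff (q ⊕ r) 0                    ≡⟨ cong (x ℤ.*_) (coeff-⊕ q r 0) ⟩
  x ℤ.* (coeff q 0 ℤ.+ coeff r 0)          ≡⟨ ℤ.*-distribˡ-+ x _ _ ⟩
  x ℤ.* coeff q 0 ℤ.+ x ℤ.* coeff r 0      ≡⟨ cong₂ ℤ._+_ (coeff-∷⊗-0 x p q) (coeff-∷⊗-0 x p r) ⟨
  coeff ((x ∷ p) ⊗ q) 0 ℤ.+ coeff ((x ∷ p) ⊗ r) 0 ≡⟨ coeff-⊕ ((x ∷ p) ⊗ q) _ 0 ⟨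
  coeff (((x ∷ p) ⊗ q) ⊕ ((x ∷ p) ⊗ r)) 0  ∎
⊗-distribˡ (x ∷ p) q r (suc k) = begin
  coeff ((x ∷ p) ⊗ (q ⊕ r)) (suc k)
    ≡⟨ coeff-∷⊗-suc x p (q ⊕ r) k ⟩
  x ℤ.* coeff (q ⊕ r) (suc k) ℤ.+ coeff (p ⊗ (q ⊕ r)) k
    ≡⟨ cong₂ (λ a b → x ℤ.* a ℤ.+ b) (coeff-⊕ q r (suc k))
         (≡.trans (⊗-distribˡ p q r k) (coeff-⊕ (p ⊗ q) _ k)) ⟩
  x ℤ.* (coeff q (suc k) ℤ.+ coeff r (suc k)) ℤ.+ (coeff (p ⊗ q) k ℤ.+ coeff (p ⊗ r) k)
    ≡⟨ regroup x _ _ _ _ ⟩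
  (x ℤ.* coeff q (suc k) ℤ.+ coeff (p ⊗ q) k) ℤ.+ (x ℤ.* coeff r (suc k) ℤ.+ coeff (p ⊗ r) k)
    ≡⟨ cong₂ ℤ._+_ (coeff-∷⊗-suc x p q k) (coeff-∷⊗-suc x p r k) ⟨
  coeff ((x ∷ p) ⊗ q) (suc k) ℤ.+ coeff ((x ∷ p) ⊗ r) (suc k)
    ≡⟨ coeff-⊕ ((x ∷ p) ⊗ q) _ (suc k) ⟨
  coeff (((x ∷ p) ⊗ q) ⊕ ((x ∷ p) ⊗ r)) (suc k) ∎
  where
  regroup : ∀ x a b c d → x ℤ.* (a ℤ.+ b) ℤ.+ (c ℤ.+ d) ≡ (x ℤ.* a ℤ.+ c) ℤ.+ (x ℤ.* b ℤ.+ d)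
  regroup = ℤ-Solver.solve-∀

⊕-cong : ∀ {p p′ q q′} → p ≐ p′ → q ≐ q′ → p ⊕ q ≐ p′ ⊕ q′
⊕-cong {p} {p′} {q} {q′} p≈p′ q≈q′ k =
  ≡.trans (coeff-⊕ p q k) (≡.trans (cong₂ ℤ._+_ (p≈p′ k) (q≈q′ k)) (≡.sym (coeff-⊕ p′ q′ k)))

scale-cong : ∀ c {p q} → p ≐ q → scale c p ≐ scale c q
scale-cong c {p} {q} p≈q k =
  ≡.trans (coeff-scale c p k) (≡.trans (cong (c ℤ.*_) (p≈q k)) (≡.sym (coeff-scale c q k)))

⊗-distribʳ : ∀ p q r → (q ⊕ r) ⊗ p ≐ (q ⊗ p) ⊕ (r ⊗ p)
⊗-distribʳ p q r k = begin
  coeff ((q ⊕ r) ⊗ p) k        ≡⟨ ⊗-comm (q ⊕ r) p k ⟩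
  coeff (p ⊗ (q ⊕ r)) k        ≡⟨ ⊗-distribˡ p q r k ⟩
  coeff ((p ⊗ q) ⊕ (p ⊗ r)) k  ≡⟨ ⊕-cong {p ⊗ q} {q ⊗ p} {p ⊗ r} {r ⊗ p} (⊗-comm p q) (⊗-comm p r) k ⟩
  coeff ((q ⊗ p) ⊕ (r ⊗ p)) k  ∎

shift-⊗ : ∀ p q → (+ 0 ∷ p) ⊗ q ≐ + 0 ∷ (p ⊗ q)
shift-⊗ p q zero    = ≡.trans (coeff-∷⊗-0 (+ 0) p q) (ℤ.*-zeroˡ (coeff q 0))
shift-⊗ p q (suc k) = ≡.trans (coeff-∷⊗-suc (+ 0) p q k)
  (≡.trans (cong (ℤ._+ coeff (p ⊗ q) k) (ℤ.*-zeroˡ (coeff q (suc k)))) (ℤ.+-identityˡ _))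

⊗-assoc : ∀ p q r → (p ⊗ q) ⊗ r ≐ p ⊗ (q ⊗ r)
⊗-assoc []      q r k = refl
⊗-assoc (x ∷ p) q r k = begin
  coeff ((scale x q ⊕ (+ 0 ∷ (p ⊗ q))) ⊗ r) k
    ≡⟨ ⊗-distribʳ r (scale x q) (+ 0 ∷ (p ⊗ q)) k ⟩
  coeff ((scale x q ⊗ r) ⊕ ((+ 0 ∷ (p ⊗ q)) ⊗ r)) k
    ≡⟨ ⊕-cong {scale x q ⊗ r} {scale x (q ⊗ r)} {_} {+ 0 ∷ (p ⊗ (q ⊗ r))} (⊗-scale x q r) shifted k ⟩
  coeff (scale x (q ⊗ r) ⊕ (+ 0 ∷ (p ⊗ (q ⊗ r)))) k ∎
  where
  shifted : (+ 0 ∷ (p ⊗ q)) ⊗ r ≐ + 0 ∷ (p ⊗ (q ⊗ r))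
  shifted zero    = shift-⊗ (p ⊗ q) r zero
  shifted (suc k) = ≡.trans (shift-⊗ (p ⊗ q) r (suc k)) (⊗-assoc p q r k)

⊗-identityˡ : ∀ p → (+ 1 ∷ []) ⊗ p ≐ p
⊗-identityˡ p zero    = ≡.trans (coeff-∷⊗-0 (+ 1) [] p) (ℤ.*-identityˡ _)
⊗-identityˡ p (suc k) = ≡.trans (coeff-∷⊗-suc (+ 1) [] p k) (≡.trans (ℤ.+-identityʳ _) (ℤ.*-identityˡ _))

⊕-comm : ∀ p q → p ⊕ q ≐ q ⊕ p
⊕-comm p q k = ≡.trans (coeff-⊕ p q k) (≡.trans (ℤ.+-comm (coeff p k) _) (≡.sym (coeff-⊕ q p k)))

⊕-assoc : ∀ p q r → (p ⊕ q) ⊕ r ≐ p ⊕ (q ⊕ r)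
⊕-assoc p q r k = begin
  coeff ((p ⊕ q) ⊕ r) k                    ≡⟨ coeff-⊕ (p ⊕ q) r k ⟩
  coeff (p ⊕ q) k ℤ.+ coeff r k            ≡⟨ cong (ℤ._+ coeff r k) (coeff-⊕ p q k) ⟩
  coeff p k ℤ.+ coeff q k ℤ.+ coeff r k    ≡⟨ ℤ.+-assoc (coeff p k) _ _ ⟩
  coeff p k ℤ.+ (coeff q k ℤ.+ coeff r k)  ≡⟨ cong (λ z → coeff p k ℤ.+ z) (coeff-⊕ q r k) ⟨
  coeff p k ℤ.+ coeff (q ⊕ r) k            ≡⟨ coeff-⊕ p (q ⊕ r) k ⟨
  coeff (p ⊕ (q ⊕ r)) k                    ∎

coeff-neg : ∀ p k → coeff (neg p) k ≡ - coeff p k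
coeff-neg p k = ≡.trans (coeff-scale (- (+ 1)) p k) (ℤ.-1*i≡-i (coeff p k))

⊕-inverseʳ : ∀ p → p ⊕ neg p ≐ []
⊕-inverseʳ p k = ≡.trans (coeff-⊕ p (neg p) k)
  (≡.trans (cong (λ z → coeff p k ℤ.+ z) (coeff-neg p k)) (ℤ.+-inverseʳ (coeff p k)))

-- A record rather than a function type, so that the two polynomials can be inferred from an equation.
infix 4 _≈_
record _≈_ (p q : Poly) : Set where
  constructor coeffwise
  field coeff≡ : p ≐ q
open _≈_ public

polyRing : CommutativeRing 0ℓ 0ℓ
polyRing = record
  { Carrier = Poly
  ; _≈_ = _≈_
  ; _+_ = _⊕_
  ; _*_ = _⊗_
  ; -_ = neg
  ; 0# = []
  ; 1# = + 1 ∷ []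
  ; isCommutativeRing = record
    { isRing = record
      { +-isAbelianGroup = record
        { isGroup = record
          { isMonoid = record
            { isSemigroup = record
              { isMagma = record
                { isEquivalence = record
                  { refl = coeffwise λ k → refl
                  ; sym = λ p≈q → coeffwise λ k → ≡.sym (coeff≡ p≈q k)
                  ; trans = λ p≈q q≈r → coeffwise λ k → ≡.trans (coeff≡ p≈q k) (coeff≡ q≈r k)
                  }
                ; ∙-cong = λ {p} {p′} {q} {q′} p≈p′ q≈q′ →
                    coeffwise (⊕-cong {p} {p′} {q} {q′} (coeff≡ p≈p′) (coeff≡ q≈q′))
                }
              ; assoc = λ p q r → coeffwise (⊕-assoc p q r)
              }
            ; identity = (λ p → coeffwise λ k → refl) , (λ p → coeffwise (⊕-comm p []))
            }
          ; inverse = (λ p → coeffwise λ k → ≡.trans (⊕-comm (neg p) p k) (⊕-inverseʳ p k)) ,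
                      (λ p → coeffwise (⊕-inverseʳ p))
          ; ⁻¹-cong = λ {p} {q} p≈q → coeffwise (scale-cong (- (+ 1)) {p} {q} (coeff≡ p≈q))
          }
        ; comm = λ p q → coeffwise (⊕-comm p q)
        }
      ; *-cong = λ {p} {p′} {q} {q′} p≈p′ q≈q′ →
          coeffwise (⊗-cong {p} {p′} {q} {q′} (coeff≡ p≈p′) (coeff≡ q≈q′))
      ; *-assoc = λ p q r → coeffwise (⊗-assoc p q r)
      ; *-identity = (λ p → coeffwise (⊗-identityˡ p)) ,
                     (λ p → coeffwise λ k → ≡.trans (⊗-comm p (+ 1 ∷ []) k) (⊗-identityˡ p k))
      ; distrib = (λ p q r → coeffwise (⊗-distribˡ p q r)) , (λ p q r → coeffwise (⊗-distribʳ p q r))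
      }
    ; *-comm = λ p q → coeffwise (⊗-comm p q)
    }
  }

open CommutativeRing polyRing using ()
  renaming ( refl to ≈-refl; sym to ≈-sym; trans to ≈-trans; reflexive to ≈-reflexive; -‿cong to neg-cong′
           ; +-cong to ⊕-cong′; *-cong to ⊗-cong′; distribˡ to ⊗-distribˡ′; distribʳ to ⊗-distribʳ′)
open WeightedTrees polyRing
private module D = Determinant polyRing

-- Comparison of the two determinants

rowTerm : ∀ m → (Fin (suc m) → Fin (suc m) → Poly) → Fin (suc m) → Poly
rowTerm m M j = M zero j ⊗ det m (λ i k → M (suc i) (punchIn j k))

-- det recurses through a function local to its where block. Unfolding det twice exposes a call of that
-- function whose arguments can be generalised to distinct variables, and unification then solves for it.
mutual
  expandTail : ∀ k → (Fin (suc (suc k)) → Fin (suc (suc k)) → Poly) → Poly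
  expandTail = _

  det-step : ∀ k (M : Fin (suc (suc k)) → Fin (suc (suc k)) → Poly) →
    det (suc (suc k)) M ≡ scale (+ 1) (rowTerm (suc k) M zero)
                          ⊕ (scale (- (+ 1)) (rowTerm (suc k) M (suc zero)) ⊕ expandTail k M)
  det-step k M = refl

mutual
  expand : ∀ m → (Fin (suc m) → Fin (suc m) → Poly) → ∀ k → (Fin k → Fin (suc m)) → ℤ → Poly
  expand = _

  expandTail-expand : ∀ k (M : Fin (suc (suc k)) → Fin (suc (suc k)) → Poly) →
    expandTail k M ≡ expand (suc k) M k (λ i → suc (suc i)) (+ 1)
  expandTail-expand k M with suc k | (λ (i : Fin k) → Fin.suc (Fin.suc i)) | + 1
  ... | m | e | s = refl

-- The recursion hands the sign on as an argument and flips it, which amounts to the nested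
-- alternating sum times the current sign.
expand≈alt : ∀ m M k (e : Fin k → Fin (suc m)) s → expand m M k e s ≈ scale s (D.alt (λ i → rowTerm m M (e i)))
expand≈alt m M zero    e s = ≈-refl
expand≈alt m M (suc k) e s = coeffwise λ l → begin
  coeff (scale s t₀ ⊕ expand m M k _ (- s)) l
    ≡⟨ coeff-⊕ (scale s t₀) _ l ⟩
  coeff (scale s t₀) l ℤ.+ coeff (expand m M k _ (- s)) l
    ≡⟨ cong₂ ℤ._+_ (coeff-scale s t₀ l)
         (≡.trans (coeff≡ (expand≈alt m M k (λ i → e (suc i)) (- s)) l) (coeff-scale (- s) t₊ l)) ⟩
  s ℤ.* coeff t₀ l ℤ.+ - s ℤ.* coeff t₊ l
    ≡⟨ factor s (coeff t₀ l) (coeff t₊ l) ⟩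
  s ℤ.* (coeff t₀ l ℤ.+ - coeff t₊ l)
    ≡⟨ cong (λ z → s ℤ.* (coeff t₀ l ℤ.+ z)) (coeff-neg t₊ l) ⟨
  s ℤ.* (coeff t₀ l ℤ.+ coeff (neg t₊) l)
    ≡⟨ cong (s ℤ.*_) (coeff-⊕ t₀ (neg t₊) l) ⟨
  s ℤ.* coeff (t₀ ⊕ neg t₊) l
    ≡⟨ coeff-scale s (t₀ ⊕ neg t₊) l ⟨
  coeff (scale s (t₀ ⊕ neg t₊)) l ∎
  where
  t₀ t₊ : Poly
  t₀ = rowTerm m M (e zero)
  t₊ = D.alt (λ i → rowTerm m M (e (suc i)))
  factor : ∀ s x y → s ℤ.* x ℤ.+ - s ℤ.* y ≡ s ℤ.* (x ℤ.+ - y)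
  factor = ℤ-Solver.solve-∀

scale-1 : ∀ p → scale (+ 1) p ≈ p
scale-1 p = coeffwise λ k → ≡.trans (coeff-scale (+ 1) p k) (ℤ.*-identityˡ (coeff p k))

det≈det : ∀ m M → det m M ≈ D.det M
det≈det zero    M = ≈-refl
det≈det (suc m) M = ≈-trans (expand≈alt m M (suc m) (λ j → j) (+ 1)) (≈-trans (scale-1 _)
  (D.alt-cong {suc m} (λ j → ⊗-cong′ (≈-refl {M zero j}) (det≈det m (λ i k → M (suc i) (punchIn j k))))))

-- Reversal of polynomials

mono : ℤ → ℕ → Poly
mono c zero    = c ∷ []
mono c (suc i) = + 0 ∷ mono c i

const-⊗ : ∀ c q → (c ∷ []) ⊗ q ≈ scale c q
const-⊗ c q = coeffwise λ
  { zero    → ≡.trans (coeff-⊕ (scale c q) _ 0) (ℤ.+-identityʳ _)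
  ; (suc k) → ≡.trans (coeff-⊕ (scale c q) _ (suc k)) (ℤ.+-identityʳ _) }

scale-mono : ∀ c d j → scale c (mono d j) ≈ mono (c ℤ.* d) j
scale-mono c d zero    = ≈-refl
scale-mono c d (suc j) = coeffwise λ { zero → ℤ.*-zeroʳ c ; (suc k) → coeff≡ (scale-mono c d j) k }

mono-⊗ : ∀ c i d j → mono c i ⊗ mono d j ≈ mono (c ℤ.* d) (i ℕ.+ j)
mono-⊗ c zero    d j = ≈-trans (const-⊗ c (mono d j)) (scale-mono c d j)
mono-⊗ c (suc i) d j = coeffwise λ
  { zero    → shift-⊗ (mono c i) (mono d j) 0
  ; (suc k) → ≡.trans (shift-⊗ (mono c i) (mono d j) (suc k)) (coeff≡ (mono-⊗ c i d j) k) }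

-- Rev d p q says that q = λᵈ p(1/λ), a polynomial.
data Rev (d : ℕ) : Poly → Poly → Set where
  nil  : Rev d [] []
  term : ∀ c i j → i ℕ.+ j ≡ d → Rev d (mono c i) (mono c j)
  add  : ∀ {p q p′ q′} → Rev d p q → Rev d p′ q′ → Rev d (p ⊕ p′) (q ⊕ q′)
  resp : ∀ {p q p′ q′} → p ≈ p′ → q ≈ q′ → Rev d p q → Rev d p′ q′

-- By bilinearity it is enough to multiply monomials, where the exponents and their complements add.
Rev-⊗ : ∀ {d d′ p q p′ q′} → Rev d p q → Rev d′ p′ q′ → Rev (d ℕ.+ d′) (p ⊗ p′) (q ⊗ q′)
Rev-⊗ nil                 r′                     = nil
Rev-⊗ (add {p} {q} {p₁} {q₁} r s) r′ =
  resp (≈-sym (⊗-distribʳ′ _ p p₁)) (≈-sym (⊗-distribʳ′ _ q q₁)) (add (Rev-⊗ r r′) (Rev-⊗ s r′))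
Rev-⊗ {p′ = p′} {q′} (resp p≈ q≈ r) r′ =
  resp (⊗-cong′ p≈ (≈-refl {p′})) (⊗-cong′ q≈ (≈-refl {q′})) (Rev-⊗ r r′)
Rev-⊗ (term c i j i+j≡d)  nil                    =
  resp (≈-sym (coeffwise (⊗-[] (mono c i)))) (≈-sym (coeffwise (⊗-[] (mono c j)))) nil
Rev-⊗ (term c i j i+j≡d)  (term c′ i′ j′ i′+j′≡d′) =
  resp (≈-sym (mono-⊗ c i c′ i′)) (≈-sym (mono-⊗ c j c′ j′))
    (term (c ℤ.* c′) (i ℕ.+ i′) (j ℕ.+ j′) (≡.trans (interchange i i′ j j′) (cong₂ ℕ._+_ i+j≡d i′+j′≡d′)))
  where
  interchange : ∀ i i′ j j′ → (i ℕ.+ i′) ℕ.+ (j ℕ.+ j′) ≡ (i ℕ.+ j) ℕ.+ (i′ ℕ.+ j′)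
  interchange = ℕ-Solver.solve-∀
Rev-⊗ (term c i j i+j≡d)  (add {p} {q} {p₁} {q₁} r s) =
  resp (≈-sym (⊗-distribˡ′ (mono c i) p p₁)) (≈-sym (⊗-distribˡ′ (mono c j) q q₁))
    (add (Rev-⊗ (term c i j i+j≡d) r) (Rev-⊗ (term c i j i+j≡d) s))
Rev-⊗ (term c i j i+j≡d)  (resp p≈ q≈ r) =
  resp (⊗-cong′ (≈-refl {mono c i}) p≈) (⊗-cong′ (≈-refl {mono c j}) q≈) (Rev-⊗ (term c i j i+j≡d) r)

Rev-neg : ∀ {d p q} → Rev d p q → Rev d (neg p) (neg q)
Rev-neg {p = p} {q} r = resp (const-⊗ (- (+ 1)) p) (const-⊗ (- (+ 1)) q) (Rev-⊗ (term (- (+ 1)) 0 0 refl) r)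

coeff-mono : ∀ c i → coeff (mono c i) i ≡ c
coeff-mono c zero    = refl
coeff-mono c (suc i) = coeff-mono c i

coeff-mono-< : ∀ c i k → coeff (mono c (suc (i ℕ.+ k))) k ≡ + 0
coeff-mono-< c i zero    = refl
coeff-mono-< c i (suc k) rewrite ℕ.+-suc i k = coeff-mono-< c i k

coeff-mono-> : ∀ c i k → coeff (mono c i) (suc (k ℕ.+ i)) ≡ + 0
coeff-mono-> c zero    k = refl
coeff-mono-> c (suc i) k rewrite ℕ.+-suc k i = coeff-mono-> c i k

-- As the sums agree, `k` equals `i` exactly when `l` equals `j`; otherwise both coefficients
-- vanish.
coeff-mono-reverse : ∀ c i j k l → i ℕ.+ j ≡ k ℕ.+ l → coeff (mono c i) k ≡ coeff (mono c j) l
coeff-mono-reverse c zero    j zero    .j refl = ≡.sym (coeff-mono c j)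
coeff-mono-reverse c zero    _ (suc k) l  refl = ≡.sym (coeff-mono-< c k l)
coeff-mono-reverse c (suc i) j zero    _  refl = ≡.sym (coeff-mono-> c j i)
coeff-mono-reverse c (suc i) j (suc k) l  eq   = coeff-mono-reverse c i j k l (ℕ.suc-injective eq)

Rev-coeff : ∀ {d p q} → Rev d p q → ∀ i j → i ℕ.+ j ≡ d → coeff p i ≡ coeff q j
Rev-coeff nil i j _ = refl
Rev-coeff (term c i j i+j≡d) k l k+l≡d = coeff-mono-reverse c i j k l (≡.trans i+j≡d (≡.sym k+l≡d))
Rev-coeff (add {p} {q} {p′} {q′} r s) i j eq =
  ≡.trans (coeff-⊕ p p′ i) (≡.trans (cong₂ ℤ._+_ (Rev-coeff r i j eq) (Rev-coeff s i j eq)) (≡.sym (coeff-⊕ q q′ j)))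
Rev-coeff (resp p≈ q≈ r) i j eq = ≡.trans (≡.sym (coeff≡ p≈ i)) (≡.trans (Rev-coeff r i j eq) (coeff≡ q≈ j))

-- Q is reversed in the degree of P, one more than its own. So (λ, 1) becomes (1, λ), and both
-- products in P(t)P(s) - Q(t)Q(s) are reversed in one common degree.
RevWeight : ℕ → Weight → Weight → Set
RevWeight d (p , q) (p′ , q′) = Rev d p p′ × Rev d q q′

RevWeight-⊙ : ∀ {d e w w′ v v′} → RevWeight d w w′ → RevWeight e v v′ → RevWeight (d ℕ.+ e) (w ⊙ v) (w′ ⊙ v′)
RevWeight-⊙ (rp , rq) (sp , sq) = add (Rev-⊗ rp sp) (Rev-neg (Rev-⊗ rq sq)) , Rev-⊗ rq sp

foldConst : BT → Weight → Weight
foldConst t w = fold t (λ _ → w)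

RevWeight-fold : ∀ t {k w w′} → RevWeight k w w′ → RevWeight (size t ℕ.* k) (foldConst t w) (foldConst t w′)
RevWeight-fold •       {k} {w} {w′} r = subst (λ d → RevWeight d w w′) (≡.sym (ℕ.*-identityˡ k)) r
RevWeight-fold (t ⋈ s) {k} {w} {w′} r =
  subst (λ d → RevWeight d (foldConst (t ⋈ s) w) (foldConst (t ⋈ s) w′)) (≡.sym (ℕ.*-distribʳ-+ k (size t) (size s)))
  (RevWeight-⊙ {w = foldConst t w} {foldConst t w′} {foldConst s w} {foldConst s w′}
    (RevWeight-fold t r) (RevWeight-fold s r))

charWeight revWeight hairWeight : Weight
charWeight = mono (+ 1) 1 , mono (+ 1) 0
revWeight  = mono (+ 1) 0 , mono (+ 1) 1
hairWeight = charWeight ⊙ charWeight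

charWeight-rev : RevWeight 1 charWeight revWeight
charWeight-rev = term (+ 1) 1 0 refl , term (+ 1) 0 1 refl

foldConst-hair : ∀ c w → foldConst (hair c) w ≡ foldConst c (w ⊙ w)
foldConst-hair •       w = refl
foldConst-hair (c ⋈ d) w = cong₂ _⊙_ (foldConst-hair c w) (foldConst-hair d w)

-- Hairings are self-reverse up to sign

sgn : ℕ → ℤ
sgn zero    = + 1
sgn (suc k) = - sgn k

sgn-+ : ∀ k l → sgn (k ℕ.+ l) ≡ sgn k ℤ.* sgn l
sgn-+ zero    l = ≡.sym (ℤ.*-identityˡ (sgn l))
sgn-+ (suc k) l = ≡.trans (cong -_ (sgn-+ k l)) (ℤ.neg-distribˡ-* (sgn k) (sgn l))

scale-⊗-scale : ∀ c d p q → scale c p ⊗ scale d q ≈ scale (c ℤ.* d) (p ⊗ q)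
scale-⊗-scale c d p q = coeffwise λ k → begin
  coeff (scale c p ⊗ scale d q) k             ≡⟨ ⊗-scale c p (scale d q) k ⟩
  coeff (scale c (p ⊗ scale d q)) k           ≡⟨ coeff-scale c (p ⊗ scale d q) k ⟩
  c ℤ.* coeff (p ⊗ scale d q) k               ≡⟨ cong (c ℤ.*_) (⊗-comm p (scale d q) k) ⟩
  c ℤ.* coeff (scale d q ⊗ p) k               ≡⟨ cong (c ℤ.*_) (⊗-scale d q p k) ⟩
  c ℤ.* coeff (scale d (q ⊗ p)) k             ≡⟨ cong (c ℤ.*_) (coeff-scale d (q ⊗ p) k) ⟩
  c ℤ.* (d ℤ.* coeff (q ⊗ p) k)               ≡⟨ ℤ.*-assoc c d _ ⟨
  c ℤ.* d ℤ.* coeff (q ⊗ p) k                 ≡⟨ cong (λ z → c ℤ.* d ℤ.* z) (⊗-comm q p k) ⟩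
  c ℤ.* d ℤ.* coeff (p ⊗ q) k                 ≡⟨ coeff-scale (c ℤ.* d) (p ⊗ q) k ⟨
  coeff (scale (c ℤ.* d) (p ⊗ q)) k           ∎

scale-⊕ : ∀ c p q → scale c p ⊕ scale c q ≈ scale c (p ⊕ q)
scale-⊕ c p q = coeffwise λ k → begin
  coeff (scale c p ⊕ scale c q) k                ≡⟨ coeff-⊕ (scale c p) _ k ⟩
  coeff (scale c p) k ℤ.+ coeff (scale c q) k    ≡⟨ cong₂ ℤ._+_ (coeff-scale c p k) (coeff-scale c q k) ⟩
  c ℤ.* coeff p k ℤ.+ c ℤ.* coeff q k            ≡⟨ ℤ.*-distribˡ-+ c _ _ ⟨
  c ℤ.* (coeff p k ℤ.+ coeff q k)                ≡⟨ cong (c ℤ.*_) (coeff-⊕ p q k) ⟨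
  c ℤ.* coeff (p ⊕ q) k                          ≡⟨ coeff-scale c (p ⊕ q) k ⟨
  coeff (scale c (p ⊕ q)) k                      ∎

neg-scale : ∀ c p → neg (scale c p) ≈ scale c (neg p)
neg-scale c p = coeffwise λ k → begin
  coeff (neg (scale c p)) k    ≡⟨ coeff-neg (scale c p) k ⟩
  - coeff (scale c p) k        ≡⟨ cong -_ (coeff-scale c p k) ⟩
  - (c ℤ.* coeff p k)          ≡⟨ ℤ.neg-distribʳ-* c _ ⟩
  c ℤ.* - coeff p k            ≡⟨ cong (c ℤ.*_) (coeff-neg p k) ⟨
  c ℤ.* coeff (neg p) k        ≡⟨ coeff-scale c (neg p) k ⟨
  coeff (scale c (neg p)) k    ∎

-- ⊙ preserves this form because (- s) * (- s′) = s * s′.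
RevScaled : ℕ → ℤ → Weight → Set
RevScaled d s (p , q) = Rev d p (scale s p) × Rev d q (scale (- s) q)

RevScaled-⊙ : ∀ {d e s s′ w v} → RevScaled d s w → RevScaled e s′ v → RevScaled (d ℕ.+ e) (s ℤ.* s′) (w ⊙ v)
RevScaled-⊙ {s = s} {s′} {p , q} {p′ , q′} (rp , rq) (sp , sq) =
  resp ≈-refl
    (≈-trans (⊕-cong′ (scale-⊗-scale s s′ p p′)
                      (≈-trans (neg-cong′
                                 (subst (λ c → scale (- s) q ⊗ scale (- s′) q′ ≈ scale c (q ⊗ q′)) (negneg s s′)
                                        (scale-⊗-scale (- s) (- s′) q q′)))
                               (neg-scale (s ℤ.* s′) (q ⊗ q′))))
             (scale-⊕ (s ℤ.* s′) (p ⊗ p′) (neg (q ⊗ q′))))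
    (add (Rev-⊗ rp sp) (Rev-neg (Rev-⊗ rq sq))) ,
  resp ≈-refl
    (subst (λ c → scale (- s) q ⊗ scale s′ p′ ≈ scale c (q ⊗ p′)) (≡.sym (ℤ.neg-distribˡ-* s s′))
           (scale-⊗-scale (- s) s′ q p′))
    (Rev-⊗ rq sp)
  where
  negneg : ∀ s s′ → - s ℤ.* - s′ ≡ s ℤ.* s′
  negneg = ℤ-Solver.solve-∀

hairWeight-rev : RevScaled 2 (- (+ 1)) hairWeight
hairWeight-rev =
  resp (coeffwise λ { 0 → refl ; 1 → refl ; 2 → refl ; (suc (suc (suc k))) → refl })
       (coeffwise λ { 0 → refl ; 1 → refl ; 2 → refl ; (suc (suc (suc k))) → refl })
       (add (term (+ 1) 2 0 refl) (term (- (+ 1)) 0 2 refl)) ,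
  resp (coeffwise λ { 0 → refl ; 1 → refl ; 2 → refl ; (suc (suc (suc k))) → refl })
       (coeffwise λ { 0 → refl ; 1 → refl ; 2 → refl ; (suc (suc (suc k))) → refl })
       (term (+ 1) 1 1 refl)

-- Each vertex of `c` brings one hair and with it one factor -1, so the parity of `c` separates
-- palindromes from antipalindromes.
RevScaled-hair : ∀ c → RevScaled (size c ℕ.+ size c) (sgn (size c)) (foldConst c hairWeight)
RevScaled-hair •       = hairWeight-rev
RevScaled-hair (c ⋈ d) =
  ≡.subst₂ (λ k s → RevScaled k s (foldConst (c ⋈ d) hairWeight))
    (interchange (size c) (size d)) (≡.sym (sgn-+ (size c) (size d)))
    (RevScaled-⊙ {w = foldConst c hairWeight} {v = foldConst d hairWeight} (RevScaled-hair c) (RevScaled-hair d))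
  where
  interchange : ∀ i j → (i ℕ.+ i) ℕ.+ (j ℕ.+ j) ≡ (i ℕ.+ j) ℕ.+ (i ℕ.+ j)
  interchange = ℕ-Solver.solve-∀

coeff-hair : ∀ c i j → i ℕ.+ j ≡ size c ℕ.+ size c →
  let p = proj₁ (foldConst (hair c) charWeight) in coeff p i ≡ sgn (size c) ℤ.* coeff p j
coeff-hair c i j eq rewrite foldConst-hair c charWeight =
  ≡.trans (Rev-coeff (proj₁ (RevScaled-hair c)) i j eq) (coeff-scale (sgn (size c)) (proj₁ (foldConst c hairWeight)) j)

-- Extreme coefficients and matchings

coeff-⊗-0 : ∀ p q → coeff (p ⊗ q) 0 ≡ coeff p 0 * coeff q 0
coeff-⊗-0 []      q = ≡.sym (ℤ.*-zeroˡ (coeff q 0))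
coeff-⊗-0 (x ∷ p) q = coeff-∷⊗-0 x p q

coeff-⊗-1 : ∀ p q → coeff (p ⊗ q) 1 ≡ coeff p 0 * coeff q 1 + coeff p 1 * coeff q 0
coeff-⊗-1 []      q = lemma (coeff q 1) (coeff q 0)
  where
  lemma : ∀ y z → + 0 ≡ + 0 * y + + 0 * z
  lemma = ℤ-Solver.solve-∀
coeff-⊗-1 (x ∷ p) q = ≡.trans (coeff-∷⊗-suc x p q 0) (cong (λ z → x * coeff q 1 + z) (coeff-⊗-0 p q))

coeff-⊗-2 : ∀ p q → coeff (p ⊗ q) 2 ≡ coeff p 0 * coeff q 2 + (coeff p 1 * coeff q 1 + coeff p 2 * coeff q 0)
coeff-⊗-2 []      q = lemma (coeff q 2) (coeff q 1) (coeff q 0)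
  where
  lemma : ∀ x y z → + 0 ≡ + 0 * x + (+ 0 * y + + 0 * z)
  lemma = ℤ-Solver.solve-∀
coeff-⊗-2 (x ∷ p) q = ≡.trans (coeff-∷⊗-suc x p q 1) (cong (λ z → x * coeff q 2 + z) (coeff-⊗-1 p q))

-- This is the pair modulo λ³. Reduction respects products, so these six numbers obey a recursion of
-- their own.
record Coeffs (w : Weight) (p₀ p₁ p₂ q₀ q₁ q₂ : ℤ) : Set where
  constructor coeffs
  field
    p₀≡ : coeff (proj₁ w) 0 ≡ p₀
    p₁≡ : coeff (proj₁ w) 1 ≡ p₁
    p₂≡ : coeff (proj₁ w) 2 ≡ p₂
    q₀≡ : coeff (proj₂ w) 0 ≡ q₀
    q₁≡ : coeff (proj₂ w) 1 ≡ q₁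
    q₂≡ : coeff (proj₂ w) 2 ≡ q₂

⊙-coeffs : ∀ {w p₀ p₁ p₂ q₀ q₁ q₂ w′ p₀′ p₁′ p₂′ q₀′ q₁′ q₂′} →
  Coeffs w p₀ p₁ p₂ q₀ q₁ q₂ → Coeffs w′ p₀′ p₁′ p₂′ q₀′ q₁′ q₂′ →
  Coeffs (w ⊙ w′)
    (p₀ * p₀′ - q₀ * q₀′)
    ((p₀ * p₁′ + p₁ * p₀′) - (q₀ * q₁′ + q₁ * q₀′))
    ((p₀ * p₂′ + (p₁ * p₁′ + p₂ * p₀′)) - (q₀ * q₂′ + (q₁ * q₁′ + q₂ * q₀′)))
    (q₀ * p₀′)
    (q₀ * p₁′ + q₁ * p₀′)
    (q₀ * p₂′ + (q₁ * p₁′ + q₂ * p₀′))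
⊙-coeffs {p , q} {w′ = p′ , q′} (coeffs refl refl refl refl refl refl) (coeffs refl refl refl refl refl refl) = record
  { p₀≡ = ≡.trans (difference 0) (cong₂ _-_ (coeff-⊗-0 p p′) (coeff-⊗-0 q q′))
  ; p₁≡ = ≡.trans (difference 1) (cong₂ _-_ (coeff-⊗-1 p p′) (coeff-⊗-1 q q′))
  ; p₂≡ = ≡.trans (difference 2) (cong₂ _-_ (coeff-⊗-2 p p′) (coeff-⊗-2 q q′))
  ; q₀≡ = coeff-⊗-0 q p′
  ; q₁≡ = coeff-⊗-1 q p′
  ; q₂≡ = coeff-⊗-2 q p′
  }
  where
  difference : ∀ k → coeff ((p ⊗ p′) ⊕ neg (q ⊗ q′)) k ≡ coeff (p ⊗ p′) k - coeff (q ⊗ q′) k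
  difference k = ≡.trans (coeff-⊕ (p ⊗ p′) _ k) (cong (λ z → coeff (p ⊗ p′) k + z) (coeff-neg (q ⊗ q′) k))

resp-coeffs : ∀ {w p₀ p₁ p₂ q₀ q₁ q₂ p₀′ p₁′ p₂′ q₀′ q₁′ q₂′} →
  p₀ ≡ p₀′ → p₁ ≡ p₁′ → p₂ ≡ p₂′ → q₀ ≡ q₀′ → q₁ ≡ q₁′ → q₂ ≡ q₂′ →
  Coeffs w p₀ p₁ p₂ q₀ q₁ q₂ → Coeffs w p₀′ p₁′ p₂′ q₀′ q₁′ q₂′
resp-coeffs refl refl refl refl refl refl cs = cs

edges : BT → ℕ
edges •       = 0
edges (t ⋈ s) = suc (edges t ℕ.+ edges s)

size≡1+edges : ∀ t → size t ≡ suc (edges t)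
size≡1+edges •       = refl
size≡1+edges (t ⋈ s) = ≡.trans (cong₂ ℕ._+_ (size≡1+edges t) (size≡1+edges s)) (cong suc (ℕ.+-suc (edges t) (edges s)))

-- The low coefficients of the reversed polynomial are the top ones of the original. A join counts
-- its new edge through the product of the two linear coefficients `q₁ = 1`.
topCoeffs : ∀ t → Σ ℤ λ q₂ → Coeffs (foldConst t revWeight) (+ 1) (+ 0) (- + edges t) (+ 0) (+ 1) q₂
topCoeffs •       = + 0 , coeffs refl refl refl refl refl refl
topCoeffs (t ⋈ s) with topCoeffs t | topCoeffs s
... | q₂ , cs | q₂′ , cs′ = _ , resp-coeffs refl refl
  (≡.trans (identity (+ edges t) (+ edges s) q₂ q₂′) (cong -_ (cong (λ z → + 1 + z) (≡.sym (ℤ.pos-+ (edges t) (edges s))))))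
  refl refl refl (⊙-coeffs cs cs′)
  where
  identity : ∀ e e′ x y → (+ 1 * (- e′) + (+ 0 * + 0 + (- e) * + 1)) - (+ 0 * y + (+ 1 * + 1 + x * + 0)) ≡ - (+ 1 + (e + e′))
  identity = ℤ-Solver.solve-∀

Hairy Hairyʳ : BT → Set
Hairy t  = Σ BT λ c → ⟦ t ⟧ ≃ ⟦ hair c ⟧
Hairyʳ t = Σ BT λ c → t ≃ʳ hair c

Hairyʳ⇒Hairy : ∀ {t} → Hairyʳ t → Hairy t
Hairyʳ⇒Hairy {t} (c , t≃) = c , ≃ʳ⇒≃ {t} {hair c} t≃

Hairyʳ-⋈ : ∀ {t s} → Hairyʳ t → Hairyʳ s → Hairyʳ (t ⋈ s)
Hairyʳ-⋈ {t} {s} (c , t≃) (d , s≃) = c ⋈ d , ⋈-cong {t} {hair c} {s} {hair d} t≃ s≃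

-- Up to the sign s, the coefficients count matchings.
-- matched: t has a perfect matching, x matchings with one edge less, and t minus its root has y
-- matchings covering all but one vertex.
-- unmatched: t minus its root has a perfect matching and z matchings with one edge less, t has x matchings
-- covering all but one vertex, and d is the degree of the root.
-- dead: neither t nor t minus its root has a perfect matching.
data LowCoeffs (t : BT) : Set where
  matched : ∀ (s : ℤ) x y γ δ {q₂} →
    Coeffs (foldConst t charWeight) s (+ 0) (- (s * + x)) (+ 0) (- (s * + y)) q₂ →
    x ≡ edges t ℕ.+ γ → y ≡ 1 ℕ.+ δ →
    (γ ≡ 0 → Hairy t) → (γ ≡ 0 → δ ≡ 0 → Hairyʳ t) → LowCoeffs t
  unmatched : ∀ (s : ℤ) x z d α β {p₂} →
    Coeffs (foldConst t charWeight) (+ 0) (s * + x) p₂ s (+ 0) (- (s * + z)) →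
    x ≡ 1 ℕ.+ d ℕ.+ α → z ℕ.+ d ≡ edges t ℕ.+ β →
    (α ≡ 0 → β ≡ 0 → Hairyʳ (t ⋈ •)) → (d ≡ 0 → t ≡ •) → LowCoeffs t
  dead : ∀ {p₁ p₂ q₁ q₂} → Coeffs (foldConst t charWeight) (+ 0) p₁ p₂ (+ 0) q₁ q₂ → LowCoeffs t

allCoeffs : ∀ {t} → LowCoeffs t → Σ ℤ λ p₀ → Σ ℤ λ p₁ → Σ ℤ λ p₂ → Σ ℤ λ q₀ → Σ ℤ λ q₁ → Σ ℤ λ q₂ →
            Coeffs (foldConst t charWeight) p₀ p₁ p₂ q₀ q₁ q₂
allCoeffs (matched _ _ _ _ _ cs _ _ _ _)  = _ , _ , _ , _ , _ , _ , cs
allCoeffs (unmatched _ _ _ _ _ _ cs _ _ _ _) = _ , _ , _ , _ , _ , _ , cs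
allCoeffs (dead cs)                       = _ , _ , _ , _ , _ , _ , cs

-- A matching of a join avoids the joining edge, or uses it and matches both trees without their
-- roots. The greek letters measure the excess over matchings that always exist. In `1 + δ` it is
-- the perfect matching without the edge at the root. In `1 + d + α` the root is missed, or it is
-- matched to one of its `d` neighbours, whose former partner is missed. In `z + d` the summand `d`
-- restores the edges lost with the root.
lowCoeffs-⋈ : ∀ {t s} → LowCoeffs t → LowCoeffs s → LowCoeffs (t ⋈ s)
lowCoeffs-⋈ (dead cs) ls with allCoeffs ls
... | p , _ , _ , q , _ , _ , cs′ =
  dead (resp-coeffs (zeros p q) refl refl (ℤ.*-zeroˡ p) refl refl (⊙-coeffs cs cs′))
  where
  zeros : ∀ p q → + 0 * p - + 0 * q ≡ + 0
  zeros = ℤ-Solver.solve-∀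
lowCoeffs-⋈ lt (dead cs′) with allCoeffs lt
... | p , _ , _ , q , _ , _ , cs =
  dead (resp-coeffs (zeros p q) refl refl (ℤ.*-zeroʳ q) refl refl (⊙-coeffs cs cs′))
  where
  zeros : ∀ p q → p * + 0 - q * + 0 ≡ + 0
  zeros = ℤ-Solver.solve-∀
-- The hung tree is odd and the upper one even: the whole is odd, and deleting the root leaves the
-- odd tree as a component.
lowCoeffs-⋈ (matched s _ _ _ _ cs _ _ _ _) (unmatched s′ _ _ _ _ _ cs′ _ _ _ _) =
  dead (resp-coeffs (zeros s s′) refl refl refl refl refl (⊙-coeffs cs cs′))
  where
  zeros : ∀ s s′ → s * + 0 - + 0 * s′ ≡ + 0
  zeros = ℤ-Solver.solve-∀
lowCoeffs-⋈ {t} {t′} (matched s x y γ δ {q₂} cs x≡ y≡ _ hairy)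
                     (matched s′ x′ y′ γ′ δ′ {q₂′} cs′ x′≡ y′≡ _ hairy′) =
  matched (s * s′) (x ℕ.+ x′ ℕ.+ y ℕ.* y′) y (γ ℕ.+ γ′ ℕ.+ (δ ℕ.+ δ′ ℕ.+ δ ℕ.* δ′)) δ
    (resp-coeffs (p₀-id s s′) (p₁-id s s′ (+ y) (+ y′))
      (≡.trans (p₂-id s s′ (+ x) (+ x′) (+ y) (+ y′) q₂ q₂′) (cong (λ z → - (s * s′ * z)) (≡.sym cast)))
      (ℤ.*-zeroˡ s′) (q₁-id s s′ (+ y)) refl (⊙-coeffs cs cs′))
    (≡.trans (cong₂ ℕ._+_ (cong₂ ℕ._+_ x≡ x′≡) (cong₂ ℕ._*_ y≡ y′≡)) (count (edges t) (edges t′) γ γ′ δ δ′))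
    y≡ (λ γ≡0 → Hairyʳ⇒Hairy (both γ≡0)) (λ γ≡0 _ → both γ≡0)
  where
  p₀-id : ∀ s s′ → s * s′ - + 0 * + 0 ≡ s * s′
  p₀-id = ℤ-Solver.solve-∀
  p₁-id : ∀ s s′ y y′ → (s * + 0 + + 0 * s′) - (+ 0 * (- (s′ * y′)) + (- (s * y)) * + 0) ≡ + 0
  p₁-id = ℤ-Solver.solve-∀
  p₂-id : ∀ s s′ x x′ y y′ q q′ →
    (s * (- (s′ * x′)) + (+ 0 * + 0 + (- (s * x)) * s′)) - (+ 0 * q′ + ((- (s * y)) * (- (s′ * y′)) + q * + 0))
    ≡ - (s * s′ * (x + x′ + y * y′))
  p₂-id = ℤ-Solver.solve-∀
  q₁-id : ∀ s s′ y → + 0 * + 0 + (- (s * y)) * s′ ≡ - (s * s′ * y)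
  q₁-id = ℤ-Solver.solve-∀
  cast : + (x ℕ.+ x′ ℕ.+ y ℕ.* y′) ≡ + x + + x′ + + y * + y′
  cast = ≡.trans (ℤ.pos-+ (x ℕ.+ x′) (y ℕ.* y′)) (cong₂ _+_ (ℤ.pos-+ x x′) (ℤ.pos-* y y′))
  count : ∀ e e′ γ γ′ δ δ′ → (e ℕ.+ γ) ℕ.+ (e′ ℕ.+ γ′) ℕ.+ (1 ℕ.+ δ) ℕ.* (1 ℕ.+ δ′)
        ≡ suc (e ℕ.+ e′) ℕ.+ (γ ℕ.+ γ′ ℕ.+ (δ ℕ.+ δ′ ℕ.+ δ ℕ.* δ′))
  count = ℕ-Solver.solve-∀
  both : γ ℕ.+ γ′ ℕ.+ (δ ℕ.+ δ′ ℕ.+ δ ℕ.* δ′) ≡ 0 → Hairyʳ (t ⋈ t′)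
  both slack = Hairyʳ-⋈ (hairy (ℕ.m+n≡0⇒m≡0 γ γs) (ℕ.m+n≡0⇒m≡0 δ δs)) (hairy′ (ℕ.m+n≡0⇒n≡0 γ γs) (ℕ.m+n≡0⇒n≡0 δ δs))
    where
    γs : γ ℕ.+ γ′ ≡ 0
    γs = ℕ.m+n≡0⇒m≡0 (γ ℕ.+ γ′) slack
    δs : δ ℕ.+ δ′ ≡ 0
    δs = ℕ.m+n≡0⇒m≡0 (δ ℕ.+ δ′) (ℕ.m+n≡0⇒n≡0 (γ ℕ.+ γ′) slack)
lowCoeffs-⋈ {t} {t′} (unmatched s x z d α β {p₂} cs x≡ z≡ hairy _)
                     (matched s′ x′ y′ γ′ δ′ {q₂′} cs′ x′≡ y′≡ _ hairy′) =
  -- The missed vertex lies in `t`, or the two roots are matched to each other and it lies in `t′`.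
  -- Without the root, `t′` is one more perfectly matched component.
  unmatched (s * s′) (x ℕ.+ y′) (x′ ℕ.+ z) (suc d) (α ℕ.+ δ′) (β ℕ.+ γ′)
    (resp-coeffs (p₀-id s s′)
      (≡.trans (p₁-id s s′ (+ x) (+ y′)) (cong (s * s′ *_) (≡.sym (ℤ.pos-+ x y′))))
      refl refl (q₁-id s s′)
      (≡.trans (q₂-id s s′ (+ x′) (+ z)) (cong (λ k → - (s * s′ * k)) (≡.sym (ℤ.pos-+ x′ z))))
      (⊙-coeffs cs cs′))
    (≡.trans (cong₂ ℕ._+_ x≡ y′≡) (countˣ d α δ′))
    (begin
      x′ ℕ.+ z ℕ.+ suc d                        ≡⟨ countᶻ x′ z d ⟩
      suc (x′ ℕ.+ (z ℕ.+ d))                    ≡⟨ cong suc (cong₂ ℕ._+_ x′≡ z≡) ⟩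
      suc (edges t′ ℕ.+ γ′ ℕ.+ (edges t ℕ.+ β)) ≡⟨ countᵉ (edges t) (edges t′) β γ′ ⟩
      suc (edges t ℕ.+ edges t′) ℕ.+ (β ℕ.+ γ′) ∎)
    both (λ ())
  where
  p₀-id : ∀ s s′ → + 0 * s′ - s * + 0 ≡ + 0
  p₀-id = ℤ-Solver.solve-∀
  p₁-id : ∀ s s′ x y′ → (+ 0 * + 0 + s * x * s′) - (s * (- (s′ * y′)) + + 0 * + 0) ≡ s * s′ * (x + y′)
  p₁-id = ℤ-Solver.solve-∀
  q₁-id : ∀ s s′ → s * + 0 + + 0 * s′ ≡ + 0
  q₁-id = ℤ-Solver.solve-∀
  q₂-id : ∀ s s′ x′ z → s * (- (s′ * x′)) + (+ 0 * + 0 + (- (s * z)) * s′) ≡ - (s * s′ * (x′ + z))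
  q₂-id = ℤ-Solver.solve-∀
  countˣ : ∀ d α δ → 1 ℕ.+ d ℕ.+ α ℕ.+ (1 ℕ.+ δ) ≡ 1 ℕ.+ suc d ℕ.+ (α ℕ.+ δ)
  countˣ = ℕ-Solver.solve-∀
  countᶻ : ∀ x z d → x ℕ.+ z ℕ.+ suc d ≡ suc (x ℕ.+ (z ℕ.+ d))
  countᶻ = ℕ-Solver.solve-∀
  countᵉ : ∀ e e′ β γ → suc (e′ ℕ.+ γ ℕ.+ (e ℕ.+ β)) ≡ suc (e ℕ.+ e′) ℕ.+ (β ℕ.+ γ)
  countᵉ = ℕ-Solver.solve-∀
  both : α ℕ.+ δ′ ≡ 0 → β ℕ.+ γ′ ≡ 0 → Hairyʳ ((t ⋈ t′) ⋈ •)
  both αδ βγ = let (c , iso) = Hairyʳ-⋈ (hairy (ℕ.m+n≡0⇒m≡0 α αδ) (ℕ.m+n≡0⇒m≡0 β βγ))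
                                        (hairy′ (ℕ.m+n≡0⇒n≡0 β βγ) (ℕ.m+n≡0⇒n≡0 α αδ))
               in c , ≃ʳ-trans {(t ⋈ t′) ⋈ •} {(t ⋈ •) ⋈ t′} {hair c} (⋈-exchange t t′ •) iso
lowCoeffs-⋈ {t} {t′} (unmatched s x z d α β {p₂} cs x≡ z≡ hairy trivial)
                     (unmatched s′ x′ z′ d′ α′ β′ {p₂′} cs′ x′≡ z′≡ hairy′ trivial′) =
  -- Here the joining edge belongs to the perfect matching. Using it leaves `z + z′` choices;
  -- avoiding it misses a vertex on each side. Beyond the number of edges, (1 + d)(1 + d′) leaves
  -- `d * d′`, so equality makes one end of the joining edge a leaf.
  matched (- (s * s′)) (x ℕ.* x′ ℕ.+ z ℕ.+ z′) x′
    (β ℕ.+ β′ ℕ.+ (d ℕ.* d′ ℕ.+ (α ℕ.* (1 ℕ.+ d′ ℕ.+ α′) ℕ.+ α′ ℕ.* (1 ℕ.+ d)))) (d′ ℕ.+ α′)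
    (resp-coeffs (p₀-id s s′) (p₁-id s s′ (+ x) (+ x′))
      (≡.trans (p₂-id s s′ (+ x) (+ x′) (+ z) (+ z′) p₂ p₂′) (cong (λ k → - (- (s * s′) * k)) (≡.sym cast)))
      (ℤ.*-zeroʳ s) (q₁-id s s′ (+ x′)) refl (⊙-coeffs cs cs′))
    (begin
      x ℕ.* x′ ℕ.+ z ℕ.+ z′
        ≡⟨ cong (λ k → k ℕ.+ z ℕ.+ z′) (cong₂ ℕ._*_ x≡ x′≡) ⟩
      (1 ℕ.+ d ℕ.+ α) ℕ.* (1 ℕ.+ d′ ℕ.+ α′) ℕ.+ z ℕ.+ z′
        ≡⟨ countˣ d d′ α α′ z z′ ⟩
      suc ((z ℕ.+ d) ℕ.+ (z′ ℕ.+ d′)) ℕ.+ (d ℕ.* d′ ℕ.+ (α ℕ.* (1 ℕ.+ d′ ℕ.+ α′) ℕ.+ α′ ℕ.* (1 ℕ.+ d)))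
        ≡⟨ cong (λ k → suc k ℕ.+ (d ℕ.* d′ ℕ.+ (α ℕ.* (1 ℕ.+ d′ ℕ.+ α′) ℕ.+ α′ ℕ.* (1 ℕ.+ d)))) (cong₂ ℕ._+_ z≡ z′≡) ⟩
      suc ((edges t ℕ.+ β) ℕ.+ (edges t′ ℕ.+ β′)) ℕ.+ (d ℕ.* d′ ℕ.+ (α ℕ.* (1 ℕ.+ d′ ℕ.+ α′) ℕ.+ α′ ℕ.* (1 ℕ.+ d)))
        ≡⟨ countᵉ (edges t) (edges t′) β β′ _ ⟩
      suc (edges t ℕ.+ edges t′) ℕ.+ (β ℕ.+ β′ ℕ.+ (d ℕ.* d′ ℕ.+ (α ℕ.* (1 ℕ.+ d′ ℕ.+ α′) ℕ.+ α′ ℕ.* (1 ℕ.+ d)))) ∎)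
    x′≡ someLeaf rightLeaf
  where
  p₀-id : ∀ s s′ → + 0 * + 0 - s * s′ ≡ - (s * s′)
  p₀-id = ℤ-Solver.solve-∀
  p₁-id : ∀ s s′ x x′ → (+ 0 * (s′ * x′) + s * x * + 0) - (s * + 0 + + 0 * s′) ≡ + 0
  p₁-id = ℤ-Solver.solve-∀
  p₂-id : ∀ s s′ x x′ z z′ p p′ →
    (+ 0 * p′ + (s * x * (s′ * x′) + p * + 0)) - (s * (- (s′ * z′)) + (+ 0 * + 0 + (- (s * z)) * s′))
    ≡ - (- (s * s′) * (x * x′ + z + z′))
  p₂-id = ℤ-Solver.solve-∀
  q₁-id : ∀ s s′ x′ → s * (s′ * x′) + + 0 * + 0 ≡ - (- (s * s′) * x′)
  q₁-id = ℤ-Solver.solve-∀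
  cast : + (x ℕ.* x′ ℕ.+ z ℕ.+ z′) ≡ + x * + x′ + + z + + z′
  cast = ≡.trans (ℤ.pos-+ (x ℕ.* x′ ℕ.+ z) z′)
           (cong (_+ + z′) (≡.trans (ℤ.pos-+ (x ℕ.* x′) z) (cong (_+ + z) (ℤ.pos-* x x′))))
  countˣ : ∀ d d′ α α′ z z′ → (1 ℕ.+ d ℕ.+ α) ℕ.* (1 ℕ.+ d′ ℕ.+ α′) ℕ.+ z ℕ.+ z′
         ≡ suc ((z ℕ.+ d) ℕ.+ (z′ ℕ.+ d′)) ℕ.+ (d ℕ.* d′ ℕ.+ (α ℕ.* (1 ℕ.+ d′ ℕ.+ α′) ℕ.+ α′ ℕ.* (1 ℕ.+ d)))
  countˣ = ℕ-Solver.solve-∀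
  countᵉ : ∀ e e′ β β′ r → suc ((e ℕ.+ β) ℕ.+ (e′ ℕ.+ β′)) ℕ.+ r ≡ suc (e ℕ.+ e′) ℕ.+ (β ℕ.+ β′ ℕ.+ r)
  countᵉ = ℕ-Solver.solve-∀
  module Slack (slack : β ℕ.+ β′ ℕ.+ (d ℕ.* d′ ℕ.+ (α ℕ.* (1 ℕ.+ d′ ℕ.+ α′) ℕ.+ α′ ℕ.* (1 ℕ.+ d))) ≡ 0) where
    ββ′ : β ℕ.+ β′ ≡ 0
    ββ′ = ℕ.m+n≡0⇒m≡0 (β ℕ.+ β′) slack
    rest : d ℕ.* d′ ℕ.+ (α ℕ.* (1 ℕ.+ d′ ℕ.+ α′) ℕ.+ α′ ℕ.* (1 ℕ.+ d)) ≡ 0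
    rest = ℕ.m+n≡0⇒n≡0 (β ℕ.+ β′) slack
    dd′ : d ℕ.* d′ ≡ 0
    dd′ = ℕ.m+n≡0⇒m≡0 (d ℕ.* d′) rest
    αα′ : α ℕ.* (1 ℕ.+ d′ ℕ.+ α′) ℕ.+ α′ ℕ.* (1 ℕ.+ d) ≡ 0
    αα′ = ℕ.m+n≡0⇒n≡0 (d ℕ.* d′) rest
    α≡0 : α ≡ 0
    α≡0 = ℕ.m*n≡0⇒m≡0 α _ (ℕ.m+n≡0⇒m≡0 (α ℕ.* (1 ℕ.+ d′ ℕ.+ α′)) αα′)
    α′≡0 : α′ ≡ 0
    α′≡0 = ℕ.m*n≡0⇒m≡0 α′ _ (ℕ.m+n≡0⇒n≡0 (α ℕ.* (1 ℕ.+ d′ ℕ.+ α′)) αα′)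
    left : Hairyʳ (t ⋈ •)
    left = hairy α≡0 (ℕ.m+n≡0⇒m≡0 β ββ′)
    right : Hairyʳ (t′ ⋈ •)
    right = hairy′ α′≡0 (ℕ.m+n≡0⇒n≡0 β ββ′)
  rightLeaf : β ℕ.+ β′ ℕ.+ (d ℕ.* d′ ℕ.+ (α ℕ.* (1 ℕ.+ d′ ℕ.+ α′) ℕ.+ α′ ℕ.* (1 ℕ.+ d))) ≡ 0 → d′ ℕ.+ α′ ≡ 0 →
              Hairyʳ (t ⋈ t′)
  -- The pendant end is the lower one, so the root lies in the core and the isomorphism respects it.
  rightLeaf slack d′α′ = subst (λ r → Hairyʳ (t ⋈ r)) (≡.sym (trivial′ (ℕ.m+n≡0⇒m≡0 d′ d′α′))) (Slack.left slack)
  someLeaf : β ℕ.+ β′ ℕ.+ (d ℕ.* d′ ℕ.+ (α ℕ.* (1 ℕ.+ d′ ℕ.+ α′) ℕ.+ α′ ℕ.* (1 ℕ.+ d))) ≡ 0 → Hairy (t ⋈ t′)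
  someLeaf slack with ℕ.m*n≡0⇒m≡0∨n≡0 d (Slack.dd′ slack)
  ... | inj₂ d′≡0 = Hairyʳ⇒Hairy (rightLeaf slack (cong₂ ℕ._+_ d′≡0 (Slack.α′≡0 slack)))
  ... | inj₁ d≡0  = let (c , iso) = Hairyʳ⇒Hairy (Slack.right slack) in
    c , ≃-trans {⟦ t ⋈ t′ ⟧} {⟦ t′ ⋈ t ⟧} {⟦ hair c ⟧} (⋈-comm t t′)
          (subst (λ r → ⟦ t′ ⋈ r ⟧ ≃ ⟦ hair c ⟧) (≡.sym (trivial d≡0)) iso)

lowCoeffs : ∀ t → LowCoeffs t
-- The empty matching misses the only vertex, so `x` is 1; no matching has fewer edges than the
-- empty one, so `z` is 0.
lowCoeffs •       = unmatched (+ 1) 1 0 0 0 0 (coeffs refl refl refl refl refl refl) refl refl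
                      (λ _ _ → • , ≃ʳ-refl {• ⋈ •}) (λ _ → refl)
lowCoeffs (t ⋈ s) = lowCoeffs-⋈ (lowCoeffs t) (lowCoeffs s)

-- Leaves

⌊_⌋ : Graph → BoolGraph
⌊ G ⌋ = record { Vertex = Fin (n G) ; edge = adj G ; _≟_ = Fin._≟_ }

Cycle-map : ∀ {G K} (f : Fin (n G) → Fin (n K)) → (∀ {u v} → f u ≡ f v → u ≡ v) →
            (∀ {u v} → Adj G u v → Adj K (f u) (f v)) → Cycle G → Cycle K
Cycle-map {G} {K} f inj pres (v , ws , 3≤ , unique , linked) =
  f v , map f ws ,
  subst (3 ≤_) (≡.sym (List.length-map f (v ∷ ws))) 3≤ ,
  Unique.map⁺ inj unique ,
  subst (Linked (Adj K)) (List.map-++ f (v ∷ ws) (v ∷ [])) (Linked.map⁺ (Linked.map pres linked))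

lookup-injective : ∀ {A : Set} {xs : List A} → Unique xs → ∀ {i j} → lookup xs i ≡ lookup xs j → i ≡ j
lookup-injective (_ ∷ _)  {zero}  {zero}  _  = refl
lookup-injective (x∉ ∷ _) {zero}  {suc j} eq = contradiction eq (All.lookup x∉ (∈-lookup j))
lookup-injective (x∉ ∷ _) {suc i} {zero}  eq = contradiction (≡.sym eq) (All.lookup x∉ (∈-lookup i))
lookup-injective (_ ∷ u)  {suc i} {suc j} eq = cong suc (lookup-injective u eq)

-- The pigeonhole bound on paths guarantees that the fuel of the search for a leaf suffices.
Unique-length : ∀ {k} {xs : List (Fin k)} → Unique xs → length xs ≤ k
Unique-length u = Fin.injective⇒≤ (lookup-injective u)

-- A path that meets `z` again is cut there, and `z` becomes the base point of the cycle.
Unique-cut : ∀ {A : Set} {z : A} xs {ys} → Unique (xs ++ z ∷ ys) → Unique (z ∷ xs)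
Unique-cut []       _        = [] ∷ []
Unique-cut (x ∷ xs) (x∉ ∷ u) with All.++⁻ xs x∉ | Unique-cut xs u
... | x∉xs , x≢z ∷ _ | z∉xs ∷ uxs = ((x≢z ∘ ≡.sym) ∷ z∉xs) ∷ (x∉xs ∷ uxs)

Linked-cut : ∀ {A : Set} {R : A → A → Set} {z : A} xs {ys} → Linked R (xs ++ z ∷ ys) → Linked R (xs ++ z ∷ [])
Linked-cut []           _       = [-]
Linked-cut (x ∷ [])     (r ∷ _) = r ∷ [-]
Linked-cut (x ∷ y ∷ xs) (r ∷ l) = r ∷ Linked-cut (y ∷ xs) l

IsLeaf : (T : Graph) → Fin (n T) → Fin (n T) → Set
IsLeaf T v u = ∀ w → adj T v w ≡ does (u Fin.≟ w)

-- A path ending in a non-leaf can be prolonged, or it closes up to a cycle.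
leafBeyond : ∀ T → Acyclic T → ∀ fuel x y zs → Unique (x ∷ y ∷ zs) → Linked (Adj T) (x ∷ y ∷ zs) →
             n T < fuel ℕ.+ length (x ∷ y ∷ zs) → Σ (Fin (n T)) λ v → Σ (Fin (n T)) (IsLeaf T v)
leafBeyond T acyclic zero       x y zs u l long = contradiction (Unique-length u) (ℕ.<⇒≱ long)
leafBeyond T acyclic (suc fuel) x y zs u l@(xy ∷ l′) long
  with Fin.any? (λ z → (adj T x z Bool.≟ true) ×-dec ¬? (z Fin.≟ y))
... | no only = x , y , leaf
  where
  leaf : IsLeaf T x y
  leaf w with y Fin.≟ w
  ... | yes refl = xy
  ... | no y≢w with adj T x w in xw
  ...   | false = refl
  ...   | true  = contradiction (w , xw , y≢w ∘ ≡.sym) only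
... | yes (z , xz , z≢y) with _∈?_ Fin._≟_ z (x ∷ y ∷ zs)
...   | no z∉ = leafBeyond T acyclic fuel z x (y ∷ zs)
                  (All.¬Any⇒All¬ _ z∉ ∷ u)
                  (≡.trans (sym T z x) xz ∷ l)
                  (subst (n T <_) (≡.sym (ℕ.+-suc fuel _)) long)
...   | yes (here refl)         = contradiction (≡.trans (≡.sym xz) (irrefl T x)) λ ()
...   | yes (there (here z≡y))  = contradiction z≡y z≢y
...   | yes (there (there z∈)) with ∈-∃++ z∈
...     | r , _ , refl = ⊥-elim (acyclic
          ( z , x ∷ y ∷ r , s≤s (s≤s (s≤s z≤n))
          , Unique-cut (x ∷ y ∷ r) u
          , ≡.trans (sym T z x) xz ∷ Linked-cut (x ∷ y ∷ r) l))

leafExists : ∀ T → Connected T → Acyclic T → ∀ u v → u ≢ v →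
             Σ (Fin (n T)) λ v → Σ (Fin (n T)) (IsLeaf T v)
leafExists T connected acyclic u v u≢v with connected u v
... | []               = contradiction refl u≢v
... | _∷_ {v = w} uw _ = leafBeyond T acyclic (n T) u w [] ((u≢w ∷ []) ∷ [] ∷ []) (uw ∷ [-])
      (ℕ.≤-trans (ℕ.≤-reflexive (ℕ.+-comm 1 (n T))) (ℕ.+-monoʳ-≤ (n T) (s≤s z≤n)))
  where
  u≢w : u ≢ w
  u≢w refl = contradiction (≡.trans (≡.sym uw) (irrefl T u)) λ ()

-- Deleting a leaf

_++ʷ_ : ∀ {G u v w} → Walk G u v → Walk G v w → Walk G u w
[]      ++ʷ q = q
(e ∷ p) ++ʷ q = e ∷ (p ++ʷ q)

module _ {m} (A : Fin (suc m) → Fin (suc m) → Bool)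
         (A-sym : ∀ u v → A u v ≡ A v u) (A-irrefl : ∀ u → A u u ≡ false)
         (v : Fin (suc m)) (u : Fin m) where
  private
    T : Graph
    T = record { n = suc m ; adj = A ; sym = A-sym ; irrefl = A-irrefl }

  delete : Graph
  delete = record
    { n = m
    ; adj = λ x y → A (punchIn v x) (punchIn v y)
    ; sym = λ x y → A-sym _ _
    ; irrefl = λ x → A-irrefl _
    }

  delete-acyclic : Acyclic T → Acyclic delete
  delete-acyclic acyclic = acyclic ∘ Cycle-map {delete} {T} (punchIn v) (Fin.punchIn-injective v _ _) (λ e → e)

  module _ (leaf : IsLeaf T v (punchIn v u)) where
    private
      neighbour : ∀ {x} → A v x ≡ true → punchIn v u ≡ x
      neighbour {x} vx with punchIn v u Fin.≟ x | leaf x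
      ... | yes eq | _  = eq
      ... | no  _  | eq = contradiction (≡.trans (≡.sym vx) eq) λ ()

      -- This retraction sends the leaf to its neighbour. The edge at the leaf becomes an empty
      -- walk, so walks are carried over edge by edge, even if they visit the leaf.
      collapse : Fin (suc m) → Fin m
      collapse x with v Fin.≟ x
      ... | yes _  = u
      ... | no v≢x = punchOut v≢x

      collapse-punchIn : ∀ x → collapse (punchIn v x) ≡ x
      collapse-punchIn x with v Fin.≟ punchIn v x
      ... | yes v≡ = contradiction (≡.sym v≡) (Fin.punchInᵢ≢i v x)
      ... | no v≢  = ≡.trans (Fin.punchOut-cong v refl) (Fin.punchOut-punchIn v)

      collapse-edge : ∀ {x y} → A x y ≡ true → Walk delete (collapse x) (collapse y)
      collapse-edge {x} {y} xy with v Fin.≟ x | v Fin.≟ y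
      ... | yes refl | yes refl = []
      ... | yes refl | no v≢y   = subst (Walk delete u) u≡ []
        where
        u≡ : u ≡ punchOut v≢y
        u≡ = Fin.punchIn-injective v _ _ (≡.trans (neighbour xy) (≡.sym (Fin.punchIn-punchOut v≢y)))
      ... | no v≢x   | yes refl = subst (λ z → Walk delete z u) u≡ []
        where
        u≡ : u ≡ punchOut v≢x
        u≡ = Fin.punchIn-injective v _ _
               (≡.trans (neighbour (≡.trans (A-sym v x) xy)) (≡.sym (Fin.punchIn-punchOut v≢x)))
      ... | no v≢x   | no v≢y   =
        ≡.trans (cong₂ A (Fin.punchIn-punchOut v≢x) (Fin.punchIn-punchOut v≢y)) xy ∷ []

      collapse-walk : ∀ {x y} → Walk T x y → Walk delete (collapse x) (collapse y)
      collapse-walk []      = []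
      collapse-walk (e ∷ p) = collapse-edge e ++ʷ collapse-walk p

    delete-connected : Connected T → Connected delete
    delete-connected connected x y = ≡.subst₂ (Walk delete) (collapse-punchIn x) (collapse-punchIn y)
      (collapse-walk (connected (punchIn v x) (punchIn v y)))

    addLeaf-delete : addLeafGraph ⌊ delete ⌋ u ≃ ⌊ T ⌋
    addLeaf-delete = mk↔ₛ′ to′ from′ to∘from from∘to , pres
      where
      to′ : Maybe (Fin m) → Fin (suc m)
      to′ nothing  = v
      to′ (just x) = punchIn v x
      from′ : Fin (suc m) → Maybe (Fin m)
      from′ x with v Fin.≟ x
      ... | yes _  = nothing
      ... | no v≢x = just (punchOut v≢x)
      to∘from : ∀ x → to′ (from′ x) ≡ x
      to∘from x with v Fin.≟ x
      ... | yes v≡x = v≡x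
      ... | no v≢x  = Fin.punchIn-punchOut v≢x
      from∘to : ∀ x → from′ (to′ x) ≡ x
      from∘to nothing with v Fin.≟ v
      ... | yes _  = refl
      ... | no v≢v = contradiction refl v≢v
      from∘to (just x) with v Fin.≟ punchIn v x
      ... | yes v≡ = contradiction (≡.sym v≡) (Fin.punchInᵢ≢i v x)
      ... | no v≢  = cong just (≡.trans (Fin.punchOut-cong v refl) (Fin.punchOut-punchIn v))
      leaf′ : ∀ x → does (u Fin.≟ x) ≡ A v (punchIn v x)
      leaf′ x with u Fin.≟ x
      ... | yes refl = ≡.sym (≡.trans (leaf _) (dec-true (punchIn v u Fin.≟ punchIn v u) refl))
      ... | no u≢x   = ≡.sym (≡.trans (leaf _)
                         (dec-false (punchIn v u Fin.≟ punchIn v x) (u≢x ∘ Fin.punchIn-injective v u x)))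
      pres : ∀ x y → edge (addLeafGraph ⌊ delete ⌋ u) x y ≡ A (to′ x) (to′ y)
      pres nothing  nothing  = ≡.sym (A-irrefl v)
      pres nothing  (just y) = leaf′ y
      pres (just x) nothing  = ≡.trans (leaf′ x) (A-sym v _)
      pres (just x) (just y) = refl

    grow-≃ : (Σ BT λ t → ⌊ delete ⌋ ≃ ⟦ t ⟧) → Σ BT λ t → ⌊ T ⌋ ≃ ⟦ t ⟧
    grow-≃ (t , f) = addLeaf t x ,
      ≃-trans {⌊ T ⌋} {addLeafGraph ⌊ delete ⌋ u} {⟦ addLeaf t x ⟧}
        (≃-sym {addLeafGraph ⌊ delete ⌋ u} {⌊ T ⌋} addLeaf-delete)
        (≃-trans {addLeafGraph ⌊ delete ⌋ u} {addLeafGraph ⟦ t ⟧ x} {⟦ addLeaf t x ⟧}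
          (addLeafGraph-cong {⌊ delete ⌋} {⟦ t ⟧} f u)
          (≃-sym {⟦ addLeaf t x ⟧} {addLeafGraph ⟦ t ⟧ x} (addLeaf-≃ t x)))
      where
      x : V t
      x = to (proj₁ f) u

-- Leaves are stripped until a single vertex remains and are then put back in the code one by one.
tree≃⟦⟧ : ∀ T → IsTree T → Σ BT λ t → ⌊ T ⌋ ≃ ⟦ t ⟧
tree≃⟦⟧ record { n = suc m ; adj = A ; sym = A-sym ; irrefl = A-irrefl } (_ , connected , acyclic) =
  go m A A-sym A-irrefl connected acyclic
  where
  go : ∀ m (A : Fin (suc m) → Fin (suc m) → Bool) A-sym A-irrefl →
       let T = record { n = suc m ; adj = A ; sym = A-sym ; irrefl = A-irrefl } in
       Connected T → Acyclic T → Σ BT λ t → ⌊ T ⌋ ≃ ⟦ t ⟧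
  go zero A A-sym A-irrefl connected acyclic =
    • , mk↔ₛ′ (λ _ → tt) (λ _ → zero) (λ _ → refl) (λ { zero → refl }) , λ { zero zero → A-irrefl zero }
  go (suc m) A A-sym A-irrefl connected acyclic = grow-≃ A A-sym A-irrefl v u leaf
    (go m _ _ _ (delete-connected A A-sym A-irrefl v u leaf connected)
                (delete-acyclic A A-sym A-irrefl v u acyclic))
    where
    T : Graph
    T = record { n = suc (suc m) ; adj = A ; sym = A-sym ; irrefl = A-irrefl }
    found : Σ (Fin (suc (suc m))) λ v → Σ (Fin (suc (suc m))) (IsLeaf T v)
    found = leafExists T connected acyclic zero (suc zero) (λ ())
    v : Fin (suc (suc m))
    v = proj₁ found
    v≢u : v ≢ proj₁ (proj₂ found)
    v≢u eq = contradiction (≡.trans (≡.sym (A-irrefl v))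
               (≡.trans (proj₂ (proj₂ found) v) (dec-true (_ Fin.≟ v) (≡.sym eq)))) λ ()
    u : Fin (suc m)
    u = punchOut v≢u
    leaf : IsLeaf T v (punchIn v u)
    leaf = subst (IsLeaf T v) (≡.sym (Fin.punchIn-punchOut v≢u)) (proj₂ (proj₂ found))

-- The characteristic polynomial of a tree

-- One form adds the diagonal and the adjacency part, the other nests them; they could differ only
-- at a loop.
charEntry : ∀ b b′ → (b ≡ true → b′ ≡ false) →
  (if b then (+ 0 ∷ + 1 ∷ []) else []) ⊕ (if b′ then (- (+ 1) ∷ []) else [])
    ≈ (if b then (+ 0 ∷ + 1 ∷ []) else (if b′ then neg (+ 1 ∷ []) else []))
charEntry true  true  loop with () ← loop refl
charEntry true  false _ = ≈-refl
charEntry false true  _ = ≈-refl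
charEntry false false _ = ≈-refl

charMatrix≈ : ∀ G i j → charMatrix G i j ≈ weightMatrix ⌊ G ⌋ (λ _ → charWeight) i j
charMatrix≈ G i j = charEntry (does (i Fin.≟ j)) (adj G i j) loopless
  where
  loopless : does (i Fin.≟ j) ≡ true → adj G i j ≡ false
  loopless eq with i Fin.≟ j
  ... | yes refl = irrefl G i

χ-tree : ∀ G t → ⌊ G ⌋ ≃ ⟦ t ⟧ → χ G ≈ proj₁ (foldConst t charWeight)
χ-tree G t G≃t = ≈-trans (det≈det (n G) (charMatrix G)) (≈-trans
  (D.det-cong {n G} (λ i j → ≈-trans (charMatrix≈ G i j)
    (≈-reflexive (weightMatrix-≃ {⌊ G ⌋} {⟦ t ⟧} G≃t (λ _ → charWeight) i j))))
  (det-tree t (proj₁ G≃t) (λ _ → charWeight)))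

≃⇒size : ∀ G t → ⌊ G ⌋ ≃ ⟦ t ⟧ → n G ≡ size t
≃⇒size G t (f , _) = Perm.↔⇒≡ (↔-sym (enum t) ↔-∘ f)

⌊H⌋≃hairGraph : ∀ G → ⌊ H G ⌋ ≃ hairGraph ⌊ G ⌋
⌊H⌋≃hairGraph G = Fin.+↔⊎ , pres
  where
  pres : ∀ x y → hairAdj G x y ≡ edge (hairGraph ⌊ G ⌋) (splitAt (n G) x) (splitAt (n G) y)
  pres x y with splitAt (n G) x | splitAt (n G) y
  ... | inj₁ u | inj₁ v = refl
  ... | inj₁ u | inj₂ v = refl
  ... | inj₂ u | inj₁ v = refl
  ... | inj₂ u | inj₂ v = refl

-- Trees as graphs

root : ∀ t → V t
root •       = tt
root (t ⋈ s) = inj₁ (root t)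

isRoot-root : ∀ t → isRoot t (root t) ≡ true
isRoot-root •       = refl
isRoot-root (t ⋈ s) = isRoot-root t

edgeᵗ-sym : ∀ t x y → edgeᵗ t x y ≡ edgeᵗ t y x
edgeᵗ-sym •       x        y        = refl
edgeᵗ-sym (t ⋈ s) (inj₁ x) (inj₁ y) = edgeᵗ-sym t x y
edgeᵗ-sym (t ⋈ s) (inj₁ x) (inj₂ y) = refl
edgeᵗ-sym (t ⋈ s) (inj₂ x) (inj₁ y) = refl
edgeᵗ-sym (t ⋈ s) (inj₂ x) (inj₂ y) = edgeᵗ-sym s x y

edgeᵗ-irrefl : ∀ t x → edgeᵗ t x x ≡ false
edgeᵗ-irrefl •       x        = refl
edgeᵗ-irrefl (t ⋈ s) (inj₁ x) = edgeᵗ-irrefl t x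
edgeᵗ-irrefl (t ⋈ s) (inj₂ x) = edgeᵗ-irrefl s x

graph : BT → Graph
graph t = record
  { n = size t
  ; adj = λ i j → edgeᵗ t (to (enum t) i) (to (enum t) j)
  ; sym = λ i j → edgeᵗ-sym t _ _
  ; irrefl = λ i → edgeᵗ-irrefl t _
  }

graph≃ : ∀ t → ⌊ graph t ⌋ ≃ ⟦ t ⟧
graph≃ t = enum t , λ _ _ → refl

Edgeᵗ : ∀ t → V t → V t → Set
Edgeᵗ t x y = edgeᵗ t x y ≡ true

pathToRoot : ∀ t x → Star (Edgeᵗ t) x (root t)
pathToRoot •       x        = ε
pathToRoot (t ⋈ s) (inj₁ x) = Star.gmap inj₁ id (pathToRoot t x)
pathToRoot (t ⋈ s) (inj₂ x) = Star.gmap inj₂ id (pathToRoot s x) ◅◅ (roots ◅ ε)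
  where
  roots : Edgeᵗ (t ⋈ s) (inj₂ (root s)) (inj₁ (root t))
  roots rewrite isRoot-root t | isRoot-root s = refl

graph-walk : ∀ t {x y} → Star (Edgeᵗ t) x y → Walk (graph t) (from (enum t) x) (from (enum t) y)
graph-walk t ε       = []
graph-walk t (e ◅ p) =
  ≡.trans (cong₂ (edgeᵗ t) (strictlyInverseˡ (enum t) _) (strictlyInverseˡ (enum t) _)) e ∷ graph-walk t p

graph-connected : ∀ t → Connected (graph t)
graph-connected t u v = ≡.subst₂ (Walk (graph t)) (strictlyInverseʳ (enum t) u) (strictlyInverseʳ (enum t) v)
  (graph-walk t (pathToRoot t _ ◅◅ Star.reverse (λ {x} {y} e → ≡.trans (edgeᵗ-sym t y x) e) (pathToRoot t _)))

-- The core embeds into its hairing, hence into `T`, so acyclicity is inherited from `T` and no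
-- cycle has to be analysed in a code.
core-acyclic : ∀ T G → Acyclic T → ⌊ T ⌋ ≃ hairGraph ⌊ G ⌋ → Acyclic G
core-acyclic T G acyclic (f , pres) = acyclic ∘ Cycle-map {G} {T} (from f ∘ inj₁)
  (λ eq → Sum.inj₁-injective (to-injective (↔-sym f) eq))
  (λ {u} {v} uv → ≡.trans (pres _ _)
    (≡.trans (cong₂ (edge (hairGraph ⌊ G ⌋)) (strictlyInverseˡ f (inj₁ u)) (strictlyInverseˡ f (inj₁ v))) uv))

-- Signed palindromes

sgn-even : ∀ {k} → 2 ∣ k → sgn k ≡ + 1
sgn-even (divides q refl) = even q
  where
  even : ∀ q → sgn (q ℕ.* 2) ≡ + 1
  even zero    = refl
  even (suc q) = ≡.trans (ℤ.neg-involutive (sgn (q ℕ.* 2))) (even q)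

sgn-odd : ∀ {k} → ¬ 2 ∣ k → sgn k ≡ - (+ 1)
sgn-odd {zero}        ¬2∣k = contradiction (2 ∣0) ¬2∣k
sgn-odd {suc zero}    ¬2∣k = refl
sgn-odd {suc (suc k)} ¬2∣k =
  ≡.trans (ℤ.neg-involutive (sgn k)) (sgn-odd (λ 2∣k → ¬2∣k (∣m∣n⇒∣m+n (∣-refl {2}) 2∣k)))

-- The two halves of the theorem are the cases of sign 1 and -1, treated together with the sign as a
-- parameter.
SignedPalindromic : ℤ → Graph → Set
SignedPalindromic s G = ∀ (i : Fin (suc (n G))) → a G (toℕ i) ≡ s * a G (n G ∸ toℕ i)

T≃hair : ∀ T G c → T ≅ H G → ⌊ G ⌋ ≃ ⟦ c ⟧ → ⌊ T ⌋ ≃ ⟦ hair c ⟧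
T≃hair T G c T≅HG G≃c =
  ≃-trans {⌊ T ⌋} {⌊ H G ⌋} {⟦ hair c ⟧} T≅HG
  (≃-trans {⌊ H G ⌋} {hairGraph ⌊ G ⌋} {⟦ hair c ⟧} (⌊H⌋≃hairGraph G)
  (≃-trans {hairGraph ⌊ G ⌋} {hairGraph ⟦ c ⟧} {⟦ hair c ⟧} (hairGraph-cong {⌊ G ⌋} {⟦ c ⟧} G≃c)
  (≃-sym {⟦ hair c ⟧} {hairGraph ⟦ c ⟧} (⟦hair⟧≃hairGraph c))))

hairing-signedPalindromic : ∀ T G → IsTree G → T ≅ H G → SignedPalindromic (sgn (n G)) T
hairing-signedPalindromic T G tree T≅HG i with tree≃⟦⟧ G tree
... | c , G≃c = begin
  coeff (χ T) k                                         ≡⟨ coeff≡ χT≈ k ⟩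
  coeff (proj₁ (foldConst (hair c) charWeight)) k       ≡⟨ coeff-hair c k l k+l≡ ⟩
  sgn (size c) * coeff (proj₁ (foldConst (hair c) charWeight)) l
    ≡⟨ cong₂ _*_ (cong sgn (≃⇒size G c G≃c)) (coeff≡ χT≈ l) ⟨
  sgn (n G) * coeff (χ T) l ∎
  where
  k l : ℕ
  k = n T ∸ toℕ i
  l = n T ∸ k
  χT≈ : χ T ≈ proj₁ (foldConst (hair c) charWeight)
  χT≈ = χ-tree T (hair c) (T≃hair T G c T≅HG G≃c)
  k+l≡ : k ℕ.+ l ≡ size c ℕ.+ size c
  k+l≡ = ≡.trans (ℕ.m+[n∸m]≡n (ℕ.m∸n≤m (n T) (toℕ i)))
           (≡.trans (Perm.↔⇒≡ (proj₁ T≅HG)) (cong₂ ℕ._+_ (≃⇒size G c G≃c) (≃⇒size G c G≃c)))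

coeff-χ-reverse : ∀ T t → ⌊ T ⌋ ≃ ⟦ t ⟧ → ∀ i j → i ℕ.+ j ≡ n T →
                  coeff (χ T) i ≡ coeff (proj₁ (foldConst t revWeight)) j
coeff-χ-reverse T t T≃t i j i+j≡n = ≡.trans (coeff≡ (χ-tree T t T≃t) i)
  (Rev-coeff (proj₁ (RevWeight-fold t {w = charWeight} {revWeight} charWeight-rev)) i j
    (≡.trans i+j≡n (≡.trans (≃⇒size T t T≃t) (≡.sym (ℕ.*-identityʳ (size t))))))

χ-monic : ∀ T t → ⌊ T ⌋ ≃ ⟦ t ⟧ → coeff (χ T) (n T) ≡ + 1
χ-monic T t T≃t = ≡.trans (coeff-χ-reverse T t T≃t (n T) 0 (ℕ.+-identityʳ (n T))) (Coeffs.p₀≡ (proj₂ (topCoeffs t)))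

signedPalindromic-at : ∀ T {s} → SignedPalindromic s T → ∀ k l → k ℕ.+ l ≡ n T → coeff (χ T) k ≡ s * coeff (χ T) l
signedPalindromic-at T {s} pal k l k+l≡n =
  ≡.subst₂ (λ x y → coeff (χ T) x ≡ s * coeff (χ T) y) nl≡k (≡.trans (cong (n T ∸_) nl≡k) nk≡l)
    (subst (λ i → a T i ≡ s * a T (n T ∸ i)) (Fin.toℕ-fromℕ< l<) (pal (fromℕ< l<)))
  where
  l< : l ℕ.< suc (n T)
  l< = s≤s (subst (l ≤_) k+l≡n (ℕ.m≤n+m l k))
  nl≡k : n T ∸ l ≡ k
  nl≡k = ≡.trans (cong (_∸ l) (≡.sym k+l≡n)) (ℕ.m+n∸n≡m k l)
  nk≡l : n T ∸ k ≡ l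
  nk≡l = ≡.trans (cong (_∸ k) (≡.sym k+l≡n)) (ℕ.m+n∸m≡n k l)

-- The symmetry pairs the constant coefficient with the leading 1.
χ-constant : ∀ T t → ⌊ T ⌋ ≃ ⟦ t ⟧ → ∀ {s} → SignedPalindromic s T → coeff (χ T) 0 ≡ s
χ-constant T t T≃t {s} pal =
  ≡.trans (signedPalindromic-at T {s} pal 0 (n T) refl) (≡.trans (cong (s *_) (χ-monic T t T≃t)) (ℤ.*-identityʳ s))

tree-hairy : ∀ s → s * s ≡ + 1 → ∀ T t → ⌊ T ⌋ ≃ ⟦ t ⟧ → SignedPalindromic s T → Hairy t
tree-hairy s ss≡1 T t T≃t pal with lowCoeffs t
... | dead cs = contradiction (≡.trans (≡.sym ss≡1) (cong (λ z → z * z) s≡0)) λ ()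
  where
  s≡0 : s ≡ + 0
  s≡0 = ≡.trans (≡.sym (χ-constant T t T≃t pal)) (≡.trans (coeff≡ (χ-tree T t T≃t) 0) (Coeffs.p₀≡ cs))
... | unmatched _ _ _ _ _ _ cs _ _ _ _ = contradiction (≡.trans (≡.sym ss≡1) (cong (λ z → z * z) s≡0)) λ ()
  where
  s≡0 : s ≡ + 0
  s≡0 = ≡.trans (≡.sym (χ-constant T t T≃t pal)) (≡.trans (coeff≡ (χ-tree T t T≃t) 0) (Coeffs.p₀≡ cs))
... | matched s′ x y γ δ cs x≡ y≡ hairy _ = hairy (ℕ.+-cancelˡ-≡ (edges t) γ 0 (begin
  edges t ℕ.+ γ ≡⟨ x≡ ⟨
  x             ≡⟨ ℤ.+-injective x≡edges ⟩
  edges t       ≡⟨ ℕ.+-identityʳ (edges t) ⟨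
  edges t ℕ.+ 0 ∎))
  where
  s≡s′ : s ≡ s′
  s≡s′ = ≡.trans (≡.sym (χ-constant T t T≃t pal)) (≡.trans (coeff≡ (χ-tree T t T≃t) 0) (Coeffs.p₀≡ cs))
  -- The truncated `n T ∸ 2` has to be a genuine difference. A single vertex is excluded, because
  -- its constant coefficient is 0 while `s * s` is 1.
  size≥2 : ∀ t → coeff (proj₁ (foldConst t charWeight)) 0 ≡ s → 2 ≤ size t
  size≥2 •       0≡s = contradiction (≡.trans (≡.sym ss≡1) (cong (λ z → z * z) (≡.sym 0≡s))) λ ()
  size≥2 (t ⋈ r) _ rewrite size≡1+edges t | size≡1+edges r | ℕ.+-suc (edges t) (edges r) = s≤s (s≤s z≤n)
  2≤n : 2 ≤ n T
  2≤n = subst (2 ≤_) (≡.sym (≃⇒size T t T≃t))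
          (size≥2 t (≡.trans (≡.sym (coeff≡ (χ-tree T t T≃t) 0)) (χ-constant T t T≃t pal)))
  second : - (s * + x) ≡ s * - (+ edges t)
  second = begin
    - (s * + x)                                         ≡⟨ cong (λ z → - (z * + x)) s≡s′ ⟩
    - (s′ * + x)                                        ≡⟨ Coeffs.p₂≡ cs ⟨
    coeff (proj₁ (foldConst t charWeight)) 2            ≡⟨ coeff≡ (χ-tree T t T≃t) 2 ⟨
    coeff (χ T) 2
      ≡⟨ signedPalindromic-at T {s} pal 2 (n T ∸ 2) (ℕ.m+[n∸m]≡n 2≤n) ⟩
    s * coeff (χ T) (n T ∸ 2)
      ≡⟨ cong (s *_) (≡.trans (coeff-χ-reverse T t T≃t (n T ∸ 2) 2 (ℕ.m∸n+n≡m 2≤n))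
                              (Coeffs.p₂≡ (proj₂ (topCoeffs t)))) ⟩
    s * - (+ edges t) ∎
  cancel : ∀ s x → - s * - (s * x) ≡ s * s * x
  cancel = ℤ-Solver.solve-∀
  cancel′ : ∀ s x → - s * (s * - x) ≡ s * s * x
  cancel′ = ℤ-Solver.solve-∀
  x≡edges : + x ≡ + edges t
  x≡edges = begin
    + x                         ≡⟨ ℤ.*-identityˡ (+ x) ⟨
    + 1 * + x                   ≡⟨ cong (_* + x) ss≡1 ⟨
    s * s * + x                 ≡⟨ cancel s (+ x) ⟨
    - s * - (s * + x)           ≡⟨ cong (- s *_) second ⟩
    - s * (s * - (+ edges t))   ≡⟨ cancel′ s (+ edges t) ⟩
    s * s * + edges t           ≡⟨ cong (_* + edges t) ss≡1 ⟩
    + 1 * + edges t             ≡⟨ ℤ.*-identityˡ (+ edges t) ⟩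
    + edges t                   ∎

signedPalindromic⇒hairing : ∀ s → s * s ≡ + 1 → ∀ T → IsTree T → SignedPalindromic s T →
  Σ Graph λ G → IsTree G × sgn (n G) ≡ s × T ≅ H G
signedPalindromic⇒hairing s ss≡1 T tree@(_ , _ , acyclic) pal =
  graph c , isTree , sign , T≅HG
  where
  found : Σ BT λ t → ⌊ T ⌋ ≃ ⟦ t ⟧
  found = tree≃⟦⟧ T tree
  t : BT
  t = proj₁ found
  T≃t : ⌊ T ⌋ ≃ ⟦ t ⟧
  T≃t = proj₂ found
  hairy : Hairy t
  hairy = tree-hairy s ss≡1 T t T≃t pal
  c : BT
  c = proj₁ hairy
  T≃hairGraph : ⌊ T ⌋ ≃ hairGraph ⌊ graph c ⌋
  T≃hairGraph =
    ≃-trans {⌊ T ⌋} {⟦ t ⟧} {hairGraph ⌊ graph c ⌋} T≃t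
    (≃-trans {⟦ t ⟧} {⟦ hair c ⟧} {hairGraph ⌊ graph c ⌋} (proj₂ hairy)
    (≃-trans {⟦ hair c ⟧} {hairGraph ⟦ c ⟧} {hairGraph ⌊ graph c ⌋} (⟦hair⟧≃hairGraph c)
      (hairGraph-cong {⟦ c ⟧} {⌊ graph c ⌋} (≃-sym {⌊ graph c ⌋} {⟦ c ⟧} (graph≃ c)))))
  T≅HG : T ≅ H (graph c)
  T≅HG = ≃-trans {⌊ T ⌋} {hairGraph ⌊ graph c ⌋} {⌊ H (graph c) ⌋} T≃hairGraph
    (≃-sym {⌊ H (graph c) ⌋} {hairGraph ⌊ graph c ⌋} (⌊H⌋≃hairGraph (graph c)))
  isTree : IsTree (graph c)
  isTree = subst (1 ≤_) (≡.sym (size≡1+edges c)) (s≤s z≤n) , graph-connected c ,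
           core-acyclic T (graph c) acyclic T≃hairGraph
  sign : sgn (size c) ≡ s
  sign = ≡.trans (≡.sym (χ-constant T t T≃t (hairing-signedPalindromic T (graph c) isTree T≅HG))) (χ-constant T t T≃t pal)

theorem2 : (T : Graph) → IsTree T →
    (Palindromic T ⇔ Σ Graph (λ T′ → IsTree T′ × (2 ∣ n T′) × (T ≅ H T′)))
    × (Antipalindromic T ⇔ Σ Graph (λ T′ → IsTree T′ × (¬ (2 ∣ n T′)) × (T ≅ H T′)))
theorem2 T tree =
  mk⇔ (λ pal → even (signedPalindromic⇒hairing (+ 1) refl T tree (λ i → ≡.trans (pal i) (≡.sym (ℤ.*-identityˡ _)))))
      (λ (G , isTree , 2∣n , T≅HG) i → begin
        a T (toℕ i)                       ≡⟨ hairing-signedPalindromic T G isTree T≅HG i ⟩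
        sgn (n G) * a T (n T ∸ toℕ i)     ≡⟨ cong (_* a T (n T ∸ toℕ i)) (sgn-even 2∣n) ⟩
        + 1 * a T (n T ∸ toℕ i)           ≡⟨ ℤ.*-identityˡ _ ⟩
        a T (n T ∸ toℕ i)                 ∎) ,
  mk⇔ (λ pal → odd (signedPalindromic⇒hairing (- (+ 1)) refl T tree (λ i → ≡.trans (pal i) (≡.sym (ℤ.-1*i≡-i _)))))
      (λ (G , isTree , ¬2∣n , T≅HG) i → begin
        a T (toℕ i)                       ≡⟨ hairing-signedPalindromic T G isTree T≅HG i ⟩
        sgn (n G) * a T (n T ∸ toℕ i)     ≡⟨ cong (_* a T (n T ∸ toℕ i)) (sgn-odd ¬2∣n) ⟩
        - (+ 1) * a T (n T ∸ toℕ i)       ≡⟨ ℤ.-1*i≡-i _ ⟩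
        - a T (n T ∸ toℕ i)               ∎)
  where
  even : (Σ Graph λ G → IsTree G × sgn (n G) ≡ + 1 × T ≅ H G) →
         Σ Graph (λ T′ → IsTree T′ × (2 ∣ n T′) × (T ≅ H T′))
  even (G , isTree , sign , T≅HG) with 2 ∣? n G
  ... | yes 2∣n = G , isTree , 2∣n , T≅HG
  ... | no ¬2∣n = contradiction (≡.trans (≡.sym sign) (sgn-odd ¬2∣n)) λ ()
  odd : (Σ Graph λ G → IsTree G × sgn (n G) ≡ - (+ 1) × T ≅ H G) →
        Σ Graph (λ T′ → IsTree T′ × (¬ (2 ∣ n T′)) × (T ≅ H T′))
  odd (G , isTree , sign , T≅HG) =
    G , isTree , (λ 2∣n → contradiction (≡.trans (≡.sym sign) (sgn-even 2∣n)) λ ()) , T≅HG
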